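{- For any graph $G$, there is an $N \in \mathbb{N}$ such that $P_{DP}(K_1 \vee G, m) = P(K_1 \vee G, m)$ for all integers $m \geq N$.
   Context: All graphs are nonempty, finite and simple. $K_1 \vee G$ is the join of a single vertex with $G$ (the cone of $G$): a new vertex adjacent to every vertex of $G$. For $m \in \mathbb{N}$, $P(G,m)$ denotes the chromatic polynomial, the number of proper colorings of $G$ using colors from $\{1,\dots,m\}$. A cover of a graph $G$ is a pair $\mathcal{H}=(L,H)$ where $H$ is a graph and $L: V(G) \to \mathcal{P}(V(H))$ satisfies: (1) $\{L(u): u \in V(G)\}$ is a partition of $V(H)$; (2) for every $u \in V(G)$, $H[L(u)]$ is complete; (3) if $E_H(L(u),L(v))$ is nonempty then $u=v$ or $uv \in E(G)$; (4) if $uv \in E(G)$, then $E_H(L(u),L(v))$ is a matching (possibly empty). Here $E_H(S,U)$ is the set of edges of $H$ with one endpoint in $S$ and the other in $U$. The cover is $m$-fold if $|L(u)|=m$ for every $u$. An $\mathcal{H}$-coloring of $G$ is an independent set of $H$ of size $|V(G)|$. $P_{DP}(G,\mathcal{H})$ is the number of $\mathcal{H}$-colorings, and the DP color function $P_{DP}(G,m)$ is the minimum of $P_{DP}(G,\mathcal{H})$ over all $m$-fold covers $\mathcal{H}$ of $G$. -}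

module Defs where

open import Data.Bool using (Bool; true; false; not; _∧_)
open import Data.Nat using (ℕ; zero; suc; _≤_; _≡ᵇ_; s≤s; z≤n)
open import Data.Fin using (Fin; zero; suc; _≟_)
open import Data.Fin.Subset using (Subset; ∣_∣)
open import Data.Vec using (Vec; []; _∷_; lookup)
open import Data.List using (List; []; _∷_; [_]; map; concatMap; allFin; foldr; filterᵇ; length)
open import Data.Product using (Σ; _×_)
open import Relation.Nullary.Decidable using (⌊_⌋)
open import Relation.Binary.PropositionalEquality using (_≡_; _≢_)

record Graph : Set where
  field
    n        : ℕ
    nonempty : 1 ≤ n
    adj      : Fin n → Fin n → Bool
    adj-sym  : ∀ u v → adj u v ≡ adj v u
    adj-irr  : ∀ u → adj u u ≡ false
open Graph public

allᵇ : ∀ {k} → (Fin k → Bool) → Bool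
allᵇ {k} p = foldr (λ i b → p i ∧ b) true (allFin k)

count : ∀ {A : Set} → (A → Bool) → List A → ℕ
count p xs = length (filterᵇ p xs)

consF : ∀ {k m} → Fin m → (Fin k → Fin m) → Fin (suc k) → Fin m
consF c f zero    = c
consF c f (suc i) = f i

allFuns : ∀ k m → List (Fin k → Fin m)
allFuns zero    m = [ (λ ()) ]
allFuns (suc k) m = concatMap (λ f → map (λ c → consF c f) (allFin m)) (allFuns k m)

allSubsets : ∀ k → List (Subset k)
allSubsets zero    = [ [] ]
allSubsets (suc k) = concatMap (λ s → (true ∷ s) ∷ (false ∷ s) ∷ []) (allSubsets k)

cone : Graph → Graph
cone G = record
  { n        = suc (n G)
  ; nonempty = s≤s z≤n
  ; adj      = a
  ; adj-sym  = s
  ; adj-irr  = i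
  }
  where
  a : Fin (suc (n G)) → Fin (suc (n G)) → Bool
  a zero    zero    = false
  a zero    (suc v) = true
  a (suc u) zero    = true
  a (suc u) (suc v) = adj G u v
  s : ∀ u v → a u v ≡ a v u
  s zero    zero    = _≡_.refl
  s zero    (suc v) = _≡_.refl
  s (suc u) zero    = _≡_.refl
  s (suc u) (suc v) = adj-sym G u v
  i : ∀ u → a u u ≡ false
  i zero    = _≡_.refl
  i (suc u) = adj-irr G u

proper : (G : Graph) {m : ℕ} → (Fin (n G) → Fin m) → Bool
proper G f = allᵇ λ u → allᵇ λ v → not (adj G u v ∧ ⌊ f u ≟ f v ⌋)

P : Graph → ℕ → ℕ
P G m = count (proper G) (allFuns (n G) m)

-- An m-fold cover (L, H) of G.  H is a simple graph on Fin N; the map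
-- L : V(G) → P(V(H)) is encoded by the function owner : V(H) → V(G) with
-- L(u) = owner⁻¹(u), so {L(u)} is automatically a partition of V(H).
record Cover (G : Graph) (m : ℕ) : Set where
  field
    N        : ℕ
    adjH     : Fin N → Fin N → Bool
    adjH-sym : ∀ x y → adjH x y ≡ adjH y x
    adjH-irr : ∀ x → adjH x x ≡ false
    owner    : Fin N → Fin (n G)
    fold     : ∀ u → count (λ x → ⌊ owner x ≟ u ⌋) (allFin N) ≡ m
    clique   : ∀ x y → owner x ≡ owner y → x ≢ y → adjH x y ≡ true
    respects : ∀ x y → adjH x y ≡ true → owner x ≢ owner y
               → adj G (owner x) (owner y) ≡ true
    matching : ∀ x y z → adjH x y ≡ true → adjH x z ≡ true
               → owner y ≡ owner z → owner x ≢ owner y → y ≡ z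
open Cover public

independent : ∀ {G m} (C : Cover G m) → Subset (N C) → Bool
independent C s = allᵇ λ x → allᵇ λ y → not (lookup s x ∧ lookup s y ∧ adjH C x y)

PDPcover : ∀ {G m} → Cover G m → ℕ
PDPcover {G} C = count (λ s → (∣ s ∣ ≡ᵇ n G) ∧ independent C s) (allSubsets (N C))

PDP≡ : Graph → ℕ → ℕ → Set
PDP≡ G m k = Σ (Cover G m) (λ C → PDPcover C ≡ k) × (∀ (C : Cover G m) → k ≤ PDPcover C)

{-# OPTIONS --safe #-}
-- Label the lists of an m-fold cover of K₁ ∨ G by colours so that the matchings at the
-- apex are identities, and complete the matching along every edge uv of G to a
-- permutation σ_uv.  The number of colourings is then ∑_f free(f) ∏_e (1 − x_e(f)),
-- where f runs over V(G) → [m], free(f) is the number of colours not used by f, and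
-- x_e(f) indicates that f is in conflict on e.  Compare this with the same sum for
-- σ = id, expanding the product exactly to second order.  Writing D_e for the number
-- of f whose colour at an end of e is moved by σ_e:
--   * the linear terms favour the twisted cover by about ∑_e D_e / m, because
--     colouring both ends of e alike, instead of by i and σ_e(i) ≠ i, leaves one more
--     colour for the apex;
--   * each quadratic term changes, after parametrising the f in conflict on both edges
--     by their values outside two vertices, in the unfavourable direction by at most
--     O(∑_e D_e) / m².
-- Hence the identity cover is optimal as soon as m is large.
module Submission where

open import Defs
open import Data.Bool using (Bool; true; false; not; _∧_; if_then_else_; T)
open import Data.Bool.Properties using (T?; T-≡; T-∧) renaming (_≟_ to _≟ᵇ_)
open import Data.Empty using (⊥-elim)
open import Data.Fin using (Fin; zero; suc; _≟_; _<_; combine; remQuot)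
open import Data.Fin.Permutation using (Permutation′; _⟨$⟩ʳ_; _⟨$⟩ˡ_; _∘ₚ_; transpose; inverseˡ; inverseʳ) renaming (id to idₚ)
open import Data.Fin.Properties using (all?; any?; <-cmp; <-irrefl; <-asym; _<?_; remQuot-combine; combine-remQuot; combine-injectiveʳ)
open import Data.Fin.Subset using (Subset; ∣_∣)
open import Data.List using (List; []; _∷_; [_]; _++_; map; length; concatMap; allFin; cartesianProductWith; cartesianProduct; filter; filterᵇ; tabulate; foldr)
open import Data.List.Membership.Propositional using (_∈_)
open import Data.List.Membership.Propositional.Properties using (∈-allFin; ∈-∃++; ∈-++⁻; ∈-++⁺ˡ; ∈-++⁺ʳ; ∈-lookup; ∈-filter⁺; ∈-filter⁻; ∈-map⁺; ∈-map⁻; ∈-cartesianProductWith⁺; ∈-cartesianProduct⁺)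
open import Data.List.Properties using (length-tabulate; length-map; length-++)
open import Data.List.Relation.Unary.All as All using (All; []; _∷_)
open import Data.List.Relation.Unary.AllPairs using (AllPairs; []; _∷_)
open import Data.List.Relation.Unary.Any using (here; there)
open import Data.List.Relation.Unary.Unique.Propositional using (Unique)
open import Data.List.Relation.Unary.Unique.Propositional.Properties using (allFin⁺; map⁺; filter⁺; cartesianProductWith⁺; cartesianProduct⁺)
open import Data.Nat using (ℕ; zero; suc; _+_; _*_; _≤_; _≡ᵇ_; z≤n; s≤s; NonZero; >-nonZero)
open import Data.Nat.ListAction using (sum)
open import Data.Nat.Properties hiding (_≟_; <-cmp; <-irrefl; <-asym; _<?_)
open import Data.Nat.Tactic.RingSolver using (solve-∀)
open import Data.Product using (Σ; ∃; _×_; _,_; proj₁; proj₂; swap)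
open import Data.Sum using (_⊎_; inj₁; inj₂)
open import Data.Vec as Vec using (Vec; []; _∷_; lookup; _[_]≔_)
open import Data.Vec.Properties using (lookup∘update; lookup∘update′; lookup∘tabulate; tabulate∘lookup; tabulate-cong; ∷-injective)
open import Function using (_∘_; id; Injective)
open import Function.Bundles using (Equivalence)
open import Relation.Binary.Definitions using (tri<; tri≈; tri>)
open import Relation.Binary.PropositionalEquality using (_≡_; _≢_; _≗_; refl; sym; trans; cong; cong₂; subst; module ≡-Reasoning)
open import Relation.Nullary using (¬_; Dec; yes; no; does)
open import Relation.Nullary.Decidable using (¬?; _×-dec_; _⊎-dec_; dec-true; dec-false; ⌊_⌋; toWitness; fromWitness)

private
  variable
    A B C : Set
    Q R : Set

-- Finite sums and indicators

∑ : List A → (A → ℕ) → ℕ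
∑ xs F = sum (map F xs)

syntax ∑ xs (λ x → e) = ∑[ x ← xs ] e

∑-cong : ∀ (xs : List A) {F G : A → ℕ} → F ≗ G → ∑ xs F ≡ ∑ xs G
∑-cong []       F≗G = refl
∑-cong (x ∷ xs) F≗G = cong₂ _+_ (F≗G x) (∑-cong xs F≗G)

∑-mono : ∀ (xs : List A) {F G : A → ℕ} → (∀ x → F x ≤ G x) → ∑ xs F ≤ ∑ xs G
∑-mono []       F≤G = z≤n
∑-mono (x ∷ xs) F≤G = +-mono-≤ (F≤G x) (∑-mono xs F≤G)

∑-distrib-+ : ∀ (xs : List A) (F G : A → ℕ) → ∑[ x ← xs ] (F x + G x) ≡ ∑ xs F + ∑ xs G
∑-distrib-+ []       F G = refl
∑-distrib-+ (x ∷ xs) F G = trans (cong (F x + G x +_) (∑-distrib-+ xs F G)) (interchange (F x) (G x) (∑ xs F) (∑ xs G))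
  where
  interchange : ∀ a b c d → a + b + (c + d) ≡ a + c + (b + d)
  interchange = solve-∀

*-distribˡ-∑ : ∀ (xs : List A) c (F : A → ℕ) → c * ∑ xs F ≡ ∑[ x ← xs ] (c * F x)
*-distribˡ-∑ []       c F = *-zeroʳ c
*-distribˡ-∑ (x ∷ xs) c F = trans (*-distribˡ-+ c (F x) (∑ xs F)) (cong (c * F x +_) (*-distribˡ-∑ xs c F))

∑-const : ∀ (xs : List A) c → ∑[ _ ← xs ] c ≡ length xs * c
∑-const []       c = refl
∑-const (x ∷ xs) c = cong (c +_) (∑-const xs c)

∑-zero : ∀ (xs : List A) → ∑[ _ ← xs ] 0 ≡ 0
∑-zero xs = trans (∑-const xs 0) (*-zeroʳ (length xs))

∑-swap : ∀ (xs : List A) (ys : List B) (F : A → B → ℕ) →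
         ∑[ x ← xs ] ∑[ y ← ys ] F x y ≡ ∑[ y ← ys ] ∑[ x ← xs ] F x y
∑-swap []       ys F = sym (∑-zero ys)
∑-swap (x ∷ xs) ys F = trans (cong (∑ ys (F x) +_) (∑-swap xs ys F))
                             (sym (∑-distrib-+ ys (F x) (λ y → ∑[ x ← xs ] F x y)))

∑-++ : ∀ (xs ys : List A) (F : A → ℕ) → ∑ (xs ++ ys) F ≡ ∑ xs F + ∑ ys F
∑-++ []       ys F = refl
∑-++ (x ∷ xs) ys F = trans (cong (F x +_) (∑-++ xs ys F)) (sym (+-assoc (F x) _ _))

∑-map : ∀ (g : A → B) (xs : List A) (F : B → ℕ) → ∑ (map g xs) F ≡ ∑ xs (F ∘ g)
∑-map g []       F = refl
∑-map g (x ∷ xs) F = cong (F (g x) +_) (∑-map g xs F)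

∑-concatMap : ∀ (g : A → List B) (xs : List A) (F : B → ℕ) →
              ∑ (concatMap g xs) F ≡ ∑[ x ← xs ] ∑ (g x) F
∑-concatMap g []       F = refl
∑-concatMap g (x ∷ xs) F = trans (∑-++ (g x) _ F) (cong (∑ (g x) F +_) (∑-concatMap g xs F))

∑-cartesianProductWith : ∀ (g : A → B → C) (xs : List A) (ys : List B) (F : C → ℕ) →
  ∑ (cartesianProductWith g xs ys) F ≡ ∑[ x ← xs ] ∑[ y ← ys ] F (g x y)
∑-cartesianProductWith g []       ys F = refl
∑-cartesianProductWith g (x ∷ xs) ys F =
  trans (∑-++ (map (g x) ys) _ F) (cong₂ _+_ (∑-map (g x) ys F) (∑-cartesianProductWith g xs ys F))

∈⇒≤∑ : ∀ {xs : List A} {x} (F : A → ℕ) → x ∈ xs → F x ≤ ∑ xs F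
∈⇒≤∑ F (here refl) = m≤m+n _ _
∈⇒≤∑ F (there x∈)  = ≤-trans (∈⇒≤∑ F x∈) (m≤n+m _ _)

∑-bounded : ∀ {R : A → Set} {xs : List A} {F c} → All R xs → (∀ {x} → R x → F x ≤ c) → ∑ xs F ≤ length xs * c
∑-bounded []       h = z≤n
∑-bounded (r ∷ rs) h = +-mono-≤ (h r) (∑-bounded rs h)

⟦_⟧ : Bool → ℕ
⟦ b ⟧ = if b then 1 else 0

𝟙 : Dec R → ℕ
𝟙 r? = ⟦ does r? ⟧

𝟙-yes : (r? : Dec R) → R → 𝟙 r? ≡ 1
𝟙-yes r? r = cong ⟦_⟧ (dec-true r? r)

𝟙-no : (r? : Dec R) → ¬ R → 𝟙 r? ≡ 0
𝟙-no r? ¬r = cong ⟦_⟧ (dec-false r? ¬r)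

1≤𝟙 : (r? : Dec R) → R → 1 ≤ 𝟙 r?
1≤𝟙 r? r = ≤-reflexive (sym (𝟙-yes r? r))

𝟙≤ : ∀ {n} (r? : Dec R) → (R → 1 ≤ n) → 𝟙 r? ≤ n
𝟙≤ (yes r) h = h r
𝟙≤ (no  _) h = z≤n

𝟙-mono : (r? : Dec R) (s? : Dec Q) → (R → Q) → 𝟙 r? ≤ 𝟙 s?
𝟙-mono r? s? h = 𝟙≤ r? (1≤𝟙 s? ∘ h)

𝟙-cong : (r? : Dec R) (s? : Dec Q) → (R → Q) → (Q → R) → 𝟙 r? ≡ 𝟙 s?
𝟙-cong r? s? h h⁻ = ≤-antisym (𝟙-mono r? s? h) (𝟙-mono s? r? h⁻)

𝟙≤1 : (r? : Dec R) → 𝟙 r? ≤ 1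
𝟙≤1 r? = 𝟙≤ r? (λ _ → ≤-refl)

𝟙-×-dec : (r? : Dec R) (s? : Dec Q) → 𝟙 (r? ×-dec s?) ≡ 𝟙 r? * 𝟙 s?
𝟙-×-dec (yes _) s? = sym (+-identityʳ _)
𝟙-×-dec (no  _) s? = refl

module _ {m} (j : Fin m) where

  private
    ∑-δ-∉ : ∀ (xs : List (Fin m)) (F : Fin m → ℕ) → All (j ≢_) xs → ∑[ i ← xs ] (𝟙 (i ≟ j) * F i) ≡ 0
    ∑-δ-∉ []       F []         = refl
    ∑-δ-∉ (x ∷ xs) F (j≢x ∷ ps) = cong₂ (λ a b → a * F x + b) (𝟙-no (x ≟ j) (j≢x ∘ sym)) (∑-δ-∉ xs F ps)

    ∑-δ-∈ : ∀ {xs : List (Fin m)} (F : Fin m → ℕ) → Unique xs → j ∈ xs → ∑[ i ← xs ] (𝟙 (i ≟ j) * F i) ≡ F j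
    ∑-δ-∈ F (j∉ ∷ _) (here refl) = trans
      (cong₂ (λ a b → a * F j + b) (𝟙-yes (j ≟ j) refl) (∑-δ-∉ _ F j∉))
      (trans (+-identityʳ _) (+-identityʳ _))
    ∑-δ-∈ F (x∉ ∷ xs!) (there j∈) = cong₂ (λ a b → a * F _ + b)
      (𝟙-no (_ ≟ j) (All.lookup x∉ j∈)) (∑-δ-∈ F xs! j∈)

  ∑-δ : ∀ (F : Fin m → ℕ) → ∑[ i ← allFin m ] (𝟙 (i ≟ j) * F i) ≡ F j
  ∑-δ F = ∑-δ-∈ F (allFin⁺ m) (∈-allFin j)

  ∑-𝟙≟ : ∑[ i ← allFin m ] 𝟙 (i ≟ j) ≡ 1
  ∑-𝟙≟ = trans (∑-cong (allFin m) (λ i → sym (*-identityʳ _))) (∑-δ (λ _ → 1))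

∑-𝟙-injective : ∀ {m} {τ : Fin m → Fin m} → Injective _≡_ _≡_ τ → ∀ j → ∑[ i ← allFin m ] 𝟙 (τ i ≟ j) ≤ 1
∑-𝟙-injective {m} {τ} inj j with any? (λ i → τ i ≟ j)
... | yes (i₀ , refl) = ≤-trans (∑-mono (allFin m) (λ i → 𝟙-mono (τ i ≟ τ i₀) (i ≟ i₀) inj)) (≤-reflexive (∑-𝟙≟ i₀))
... | no  ∄i = ≤-trans (≤-reflexive (trans (∑-cong (allFin m) (λ i → 𝟙-no (τ i ≟ j) (∄i ∘ (i ,_)))) (∑-zero (allFin m)))) z≤n

-- Sums over colour vectors

allVecs : ∀ k m → List (Vec (Fin m) k)
allVecs zero    m = [ [] ]
allVecs (suc k) m = cartesianProductWith (λ f c → c ∷ f) (allVecs k m) (allFin m)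

-- `allFuns` lists functions, which are pinned down only up to pointwise equality, hence `ext`.
-- Vectors with equal entries are equal, which the later counting by injections relies on.
∑-allFuns : ∀ k m (F : (Fin k → Fin m) → ℕ) → (∀ {f g} → f ≗ g → F f ≡ F g) →
            ∑ (allFuns k m) F ≡ ∑[ f ← allVecs k m ] F (lookup f)
∑-allFuns zero    m F ext = cong (_+ 0) (ext (λ ()))
∑-allFuns (suc k) m F ext = begin
  ∑ (allFuns (suc k) m) F
    ≡⟨ ∑-concatMap _ (allFuns k m) F ⟩
  ∑[ f ← allFuns k m ] ∑ (map (λ c → consF c f) (allFin m)) F
    ≡⟨ ∑-cong (allFuns k m) (λ f → ∑-map (λ c → consF c f) (allFin m) F) ⟩
  ∑[ f ← allFuns k m ] ∑[ c ← allFin m ] F (consF c f)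
    ≡⟨ ∑-allFuns k m _ (λ f≗g → ∑-cong (allFin m) (λ c → ext (λ { zero → refl ; (suc i) → f≗g i }))) ⟩
  ∑[ f ← allVecs k m ] ∑[ c ← allFin m ] F (consF c (lookup f))
    ≡⟨ ∑-cong (allVecs k m) (λ f → ∑-cong (allFin m) (λ c → ext (λ { zero → refl ; (suc i) → refl }))) ⟩
  ∑[ f ← allVecs k m ] ∑[ c ← allFin m ] F (lookup (c ∷ f))
    ≡⟨ ∑-cartesianProductWith _ (allVecs k m) (allFin m) _ ⟨
  ∑[ f ← allVecs (suc k) m ] F (lookup f) ∎
  where open ≡-Reasoning

∑-const-allFin : ∀ m c → ∑[ _ ← allFin m ] c ≡ m * c
∑-const-allFin m c = trans (∑-const (allFin m) c) (cong (_* c) (length-tabulate {n = m} id))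

-- Overwriting entry `a` in all ways produces every vector exactly `m` times. This is independence
-- of the coordinates without division; `∑-slice`, `∑-marginal` and `∑-thin` all come from it.
∑-resample : ∀ {k m} (a : Fin k) (F : Vec (Fin m) k → ℕ) →
             m * ∑ (allVecs k m) F ≡ ∑[ f ← allVecs k m ] ∑[ i ← allFin m ] F (f [ a ]≔ i)
∑-resample {suc k} {m} zero F = begin
  m * ∑ (allVecs (suc k) m) F
    ≡⟨ cong (m *_) (∑-cartesianProductWith _ (allVecs k m) (allFin m) F) ⟩
  m * (∑[ f ← allVecs k m ] ∑[ i ← allFin m ] F (i ∷ f))
    ≡⟨ *-distribˡ-∑ (allVecs k m) m _ ⟩
  ∑[ f ← allVecs k m ] (m * ∑[ i ← allFin m ] F (i ∷ f))
    ≡⟨ ∑-cong (allVecs k m) (λ f → sym (∑-const-allFin m _)) ⟩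
  ∑[ f ← allVecs k m ] ∑[ _ ← allFin m ] ∑[ i ← allFin m ] F (i ∷ f)
    ≡⟨ ∑-cartesianProductWith _ (allVecs k m) (allFin m) _ ⟨
  ∑[ f ← allVecs (suc k) m ] ∑[ i ← allFin m ] F (f [ zero ]≔ i) ∎
  where open ≡-Reasoning
∑-resample {suc k} {m} (suc a) F = begin
  m * ∑ (allVecs (suc k) m) F
    ≡⟨ cong (m *_) (∑-cartesianProductWith _ (allVecs k m) (allFin m) F) ⟩
  m * (∑[ f ← allVecs k m ] ∑[ c ← allFin m ] F (c ∷ f))
    ≡⟨ ∑-resample a _ ⟩
  ∑[ f ← allVecs k m ] ∑[ i ← allFin m ] ∑[ c ← allFin m ] F (c ∷ (f [ a ]≔ i))
    ≡⟨ ∑-cong (allVecs k m) (λ f → ∑-swap (allFin m) (allFin m) _) ⟩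
  ∑[ f ← allVecs k m ] ∑[ c ← allFin m ] ∑[ i ← allFin m ] F (c ∷ (f [ a ]≔ i))
    ≡⟨ ∑-cartesianProductWith _ (allVecs k m) (allFin m) _ ⟨
  ∑[ f ← allVecs (suc k) m ] ∑[ i ← allFin m ] F (f [ suc a ]≔ i) ∎
  where open ≡-Reasoning

module _ {k m : ℕ} where

  private
    Ω : List (Vec (Fin m) k)
    Ω = allVecs k m

  -- Resampling `a` leaves `τ f` unchanged, so exactly one of the `m` new values satisfies the
  -- condition.
  ∑-slice : ∀ (a : Fin k) (τ : Vec (Fin m) k → Fin m) → (∀ f i → τ (f [ a ]≔ i) ≡ τ f) →
            ∀ (F : Vec (Fin m) k → ℕ) →
            m * (∑[ f ← Ω ] (𝟙 (lookup f a ≟ τ f) * F f)) ≡ ∑[ f ← Ω ] F (f [ a ]≔ τ f)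
  ∑-slice a τ τ-indep F = begin
    m * (∑[ f ← Ω ] (𝟙 (lookup f a ≟ τ f) * F f))
      ≡⟨ ∑-resample a _ ⟩
    ∑[ f ← Ω ] ∑[ i ← allFin m ] (𝟙 (lookup (f [ a ]≔ i) a ≟ τ (f [ a ]≔ i)) * F (f [ a ]≔ i))
      ≡⟨ ∑-cong Ω (λ f → ∑-cong (allFin m) (λ i → cong (λ b → b * F (f [ a ]≔ i))
           (cong₂ (λ x y → 𝟙 (x ≟ y)) (lookup∘update a f i) (τ-indep f i)))) ⟩
    ∑[ f ← Ω ] ∑[ i ← allFin m ] (𝟙 (i ≟ τ f) * F (f [ a ]≔ i))
      ≡⟨ ∑-cong Ω (λ f → ∑-δ (τ f) _) ⟩
    ∑[ f ← Ω ] F (f [ a ]≔ τ f) ∎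
    where open ≡-Reasoning

  ∑-marginal : .{{NonZero m}} → ∀ (h : Fin m → ℕ) (p q : Fin k) →
               ∑[ f ← Ω ] h (lookup f p) ≡ ∑[ f ← Ω ] h (lookup f q)
  ∑-marginal h p q = *-cancelˡ-≡ _ _ m (trans (at p) (sym (at q)))
    where
    at : ∀ p → m * (∑[ f ← Ω ] h (lookup f p)) ≡ ∑[ f ← Ω ] ∑[ i ← allFin m ] h i
    at p = trans (∑-resample p _) (∑-cong Ω (λ f → ∑-cong (allFin m) (λ i → cong h (lookup∘update p f i))))

  -- For a fixed colour at `p`, injectivity of `τ` leaves at most one of the `m` colours at `q`. A
  -- coincidence of two colours thus saves a factor `m`.
  ∑-thin : ∀ {p q : Fin k} → p ≢ q → ∀ (h : Fin m → ℕ) {τ : Fin m → Fin m} → Injective _≡_ _≡_ τ →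
           ∀ (κ : Fin m → Fin m) →
           m * (∑[ f ← Ω ] (h (lookup f p) * 𝟙 (τ (lookup f q) ≟ κ (lookup f p)))) ≤ ∑[ f ← Ω ] h (lookup f p)
  ∑-thin {p} {q} p≢q h {τ} τ-inj κ = begin
    m * (∑[ f ← Ω ] (h (lookup f p) * 𝟙 (τ (lookup f q) ≟ κ (lookup f p))))
      ≡⟨ ∑-resample q _ ⟩
    ∑[ f ← Ω ] ∑[ i ← allFin m ] (h (lookup (f [ q ]≔ i) p) * 𝟙 (τ (lookup (f [ q ]≔ i) q) ≟ κ (lookup (f [ q ]≔ i) p)))
      ≡⟨ ∑-cong Ω (λ f → ∑-cong (allFin m) (λ i →
           cong₂ (λ x y → h x * 𝟙 (τ y ≟ κ x)) (lookup∘update′ p≢q f i) (lookup∘update q f i))) ⟩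
    ∑[ f ← Ω ] ∑[ i ← allFin m ] (h (lookup f p) * 𝟙 (τ i ≟ κ (lookup f p)))
      ≡⟨ ∑-cong Ω (λ f → sym (*-distribˡ-∑ (allFin m) (h (lookup f p)) _)) ⟩
    ∑[ f ← Ω ] (h (lookup f p) * ∑[ i ← allFin m ] 𝟙 (τ i ≟ κ (lookup f p)))
      ≤⟨ ∑-mono Ω (λ f → *-monoʳ-≤ (h (lookup f p)) (∑-𝟙-injective τ-inj (κ (lookup f p)))) ⟩
    ∑[ f ← Ω ] (h (lookup f p) * 1)
      ≡⟨ ∑-cong Ω (λ f → *-identityʳ _) ⟩
    ∑[ f ← Ω ] h (lookup f p) ∎
    where open ≤-Reasoning

-- First-conflict expansion, i.e. Bonferroni's inequality made exact by the remainder `pairs`.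

module Expansion {E : Set} {R : E → Set} (r? : ∀ e → Dec (R e)) where

  none? : (es : List E) → Dec (All (¬_ ∘ R) es)
  none? = All.all? (¬? ∘ r?)

  -- The event that some conflict occurs, split according to the conflict that comes latest in the
  -- list.
  first : List E → ℕ
  first []       = 0
  first (e ∷ es) = 𝟙 (r? e) * 𝟙 (none? es) + first es

  -- A pair is a conflict together with the latest conflict after it, so `c` conflicts give `c - 1`
  -- pairs when `c` is positive.
  pairs : List E → ℕ
  pairs []       = 0
  pairs (e ∷ es) = 𝟙 (r? e) * first es + pairs es

  none-∷ : ∀ e es → 𝟙 (none? (e ∷ es)) + 𝟙 (r? e) * 𝟙 (none? es) ≡ 𝟙 (none? es)
  none-∷ e es with does (r? e)
  ... | true  = +-identityʳ _
  ... | false = +-identityʳ _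

  none+first : ∀ es → 𝟙 (none? es) + first es ≡ 1
  none+first []       = refl
  none+first (e ∷ es) = begin
    𝟙 (none? (e ∷ es)) + (𝟙 (r? e) * 𝟙 (none? es) + first es) ≡⟨ +-assoc (𝟙 (none? (e ∷ es))) _ _ ⟨
    𝟙 (none? (e ∷ es)) + 𝟙 (r? e) * 𝟙 (none? es) + first es   ≡⟨ cong (_+ first es) (none-∷ e es) ⟩
    𝟙 (none? es) + first es                                   ≡⟨ none+first es ⟩
    1                                                         ∎
    where open ≡-Reasoning

  -- Both sides are 1 without conflicts and otherwise the number of conflicts. Sums on both sides
  -- avoid truncated subtraction.
  none+∑ : ∀ es → 𝟙 (none? es) + ∑ es (𝟙 ∘ r?) ≡ 1 + pairs es
  none+∑ []       = refl
  none+∑ (e ∷ es) = begin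
    n₁ + (r + s)              ≡⟨ cong (λ z → n₁ + (z + s)) (sym (trans (cong (r *_) (none+first es)) (*-identityʳ r))) ⟩
    n₁ + (r * (n₀ + f) + s)    ≡⟨ regroup n₁ r n₀ f s ⟩
    (n₁ + r * n₀) + s + r * f  ≡⟨ cong (λ z → z + s + r * f) (none-∷ e es) ⟩
    n₀ + s + r * f             ≡⟨ cong (_+ r * f) (none+∑ es) ⟩
    1 + pairs es + r * f      ≡⟨ cong suc (+-comm (pairs es) _) ⟩
    1 + (r * f + pairs es)    ∎
    where
    open ≡-Reasoning
    n₁ = 𝟙 (none? (e ∷ es))
    n₀ = 𝟙 (none? es)
    r = 𝟙 (r? e)
    s = ∑ es (𝟙 ∘ r?)
    f = first es
    regroup : ∀ a b c d e → a + (b * (c + d) + e) ≡ (a + b * c) + e + b * d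
    regroup = solve-∀

-- Twisted colourings

Edge : ℕ → Set
Edge k = Fin k × Fin k

Loopless : ∀ {k} → Edge k → Set
Loopless (u , v) = u ≢ v

Distinct : ∀ {k} → Edge k → Edge k → Set
Distinct e e′ = e ≢ e′ × e ≢ swap e′

_~_ : ∀ {k} → Edge k → Edge k → Set
d ~ e = d ≡ e ⊎ d ≡ swap e

-- An end of e that is not an end of e′ is turned into the head.
orient : ∀ {k} (e e′ : Edge k) → Loopless e → Distinct e e′ →
         Σ (Edge k) λ d → d ~ e × Loopless d × proj₂ d ≢ proj₁ e′ × proj₂ d ≢ proj₂ e′
orient (u , v) (u′ , v′) u≢v (e≢e′ , e≢e′ᵒ) with v ≟ u′ | v ≟ v′
... | no v≢u′  | no v≢v′  = (u , v) , inj₁ refl , u≢v , v≢u′ , v≢v′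
... | yes refl | _        = (v , u) , inj₂ refl , u≢v ∘ sym , u≢v , (λ { refl → e≢e′ᵒ refl })
... | no _     | yes refl = (v , u) , inj₂ refl , u≢v ∘ sym , (λ { refl → e≢e′ refl }) , u≢v

-- The matchings of a cover, completed to bijections: colour `i` at `u` is in conflict with colour
-- `σ u v i` at `v`. `Symmetric` makes the two directions mutually inverse.
Twist : ℕ → ℕ → Set
Twist k m = Fin k → Fin k → Fin m → Fin m

Symmetric : ∀ {k m} → Twist k m → Set
Symmetric σ = ∀ {u v} → u ≢ v → ∀ i → σ v u (σ u v i) ≡ i

straight : ∀ {k m} → Twist k m
straight _ _ i = i

straight-symmetric : ∀ {k m} → Symmetric (straight {k} {m})
straight-symmetric _ _ = refl

module _ {k m : ℕ} where

  private
    Ω : List (Vec (Fin m) k)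
    Ω = allVecs k m

  Conflict : Twist k m → Vec (Fin m) k → Edge k → Set
  Conflict σ f (u , v) = lookup f v ≡ σ u v (lookup f u)

  conflict? : ∀ σ f e → Dec (Conflict σ f e)
  conflict? σ f (u , v) = lookup f v ≟ σ u v (lookup f u)

  conflict-~ : ∀ σ → Symmetric σ → ∀ {d e} → d ~ e → Loopless d → ∀ f →
               𝟙 (conflict? σ f d) ≡ 𝟙 (conflict? σ f e)
  conflict-~ σ sy (inj₁ refl) d-ok f = refl
  conflict-~ σ sy {e = e} (inj₂ refl) d-ok f = 𝟙-cong (conflict? σ f (swap e)) (conflict? σ f e)
    (λ c → trans (sym (sy d-ok _)) (cong (σ _ _) (sym c)))
    (λ c → trans (sym (sy (d-ok ∘ sym) _)) (cong (σ _ _) (sym c)))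

  open module Exp (σ : Twist k m) (f : Vec (Fin m) k) = Expansion (conflict? σ f) public

  Avoids : Vec (Fin m) k → Fin m → Set
  Avoids f c = ∀ z → lookup f z ≢ c

  avoids? : ∀ f c → Dec (Avoids f c)
  avoids? f c = all? (λ z → ¬? (lookup f z ≟ c))

  -- The number of colours left for the apex of the cone.
  free : Vec (Fin m) k → ℕ
  free f = ∑[ c ← allFin m ] 𝟙 (avoids? f c)

  free≤m : ∀ f → free f ≤ m
  free≤m f = ≤-trans (∑-mono (allFin m) (λ c → 𝟙≤1 (avoids? f c)))
                     (≤-reflexive (trans (∑-const-allFin m 1) (*-identityʳ m)))

  -- Only `i` and `j` can be used by `g` without being used by `f`, so at most two free colours are
  -- lost.
  free-perturb : ∀ f g {i j} → (∀ z → lookup g z ≡ lookup f z ⊎ lookup g z ≡ i ⊎ lookup g z ≡ j) →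
                 free f ≤ free g + 2
  free-perturb f g {i} {j} h = begin
    free f
      ≤⟨ ∑-mono (allFin m) pointwise ⟩
    ∑[ c ← allFin m ] (𝟙 (avoids? g c) + (𝟙 (c ≟ i) + 𝟙 (c ≟ j)))
      ≡⟨ ∑-distrib-+ (allFin m) _ _ ⟩
    free g + ∑[ c ← allFin m ] (𝟙 (c ≟ i) + 𝟙 (c ≟ j))
      ≡⟨ cong (free g +_) (trans (∑-distrib-+ (allFin m) _ _) (cong₂ _+_ (∑-𝟙≟ i) (∑-𝟙≟ j))) ⟩
    free g + 2 ∎
    where
    open ≤-Reasoning
    pointwise : ∀ c → 𝟙 (avoids? f c) ≤ 𝟙 (avoids? g c) + (𝟙 (c ≟ i) + 𝟙 (c ≟ j))
    pointwise c with c ≟ i | c ≟ j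
    ... | yes _  | _      = ≤-trans (𝟙≤1 (avoids? f c)) (≤-trans (s≤s z≤n) (m≤n+m _ (𝟙 (avoids? g c))))
    ... | no _   | yes _  = ≤-trans (𝟙≤1 (avoids? f c)) (m≤n+m _ (𝟙 (avoids? g c)))
    ... | no c≢i | no c≢j = ≤-trans (𝟙-mono (avoids? f c) (avoids? g c) lift) (m≤m+n _ _)
      where
      lift : Avoids f c → Avoids g c
      lift av z gz≡c with h z
      ... | inj₁ gz≡fz        = av z (trans (sym gz≡fz) gz≡c)
      ... | inj₂ (inj₁ gz≡i) = c≢i (trans (sym gz≡c) gz≡i)
      ... | inj₂ (inj₂ gz≡j) = c≢j (trans (sym gz≡c) gz≡j)

  -- Moved colours and the linear terms.

  module _ .{{_ : NonZero m}} (σ : Twist k m) (σ-symmetric : Symmetric σ) where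

    σ-injective : ∀ {u v} → u ≢ v → Injective _≡_ _≡_ (σ u v)
    σ-injective u≢v {i} {j} eq = trans (sym (σ-symmetric u≢v i)) (trans (cong (σ _ _) eq) (σ-symmetric u≢v j))

    moved : Edge k → Fin m → ℕ
    moved (u , v) i = 𝟙 (¬? (σ u v i ≟ i))

    -- This is `m ^ (k - 1)` times the number of moved colours. Summing over whole colourings keeps
    -- powers of `m` out of the bounds.
    defect : Edge k → ℕ
    defect e = ∑[ f ← Ω ] moved e (lookup f (proj₁ e))

    moved-at : ∀ e p → ∑[ f ← Ω ] moved e (lookup f p) ≡ defect e
    moved-at e p = ∑-marginal (moved e) p (proj₁ e)

    -- A permutation and its inverse have the same fixed points, and `moved-at` lets the colour be
    -- read at either end.
    defect-~ : ∀ {d e} → d ~ e → Loopless d → defect d ≡ defect e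
    defect-~ (inj₁ refl) d-ok = refl
    defect-~ {e = e@(u , v)} (inj₂ refl) d-ok = trans
      (∑-cong Ω (λ f → 𝟙-cong (¬? (σ v u (lookup f v) ≟ lookup f v)) (¬? (σ u v (lookup f v) ≟ lookup f v))
        (λ ne eq → ne (trans (cong (σ v u) (sym eq)) (σ-symmetric (d-ok ∘ sym) _)))
        (λ ne eq → ne (trans (cong (σ u v) (sym eq)) (σ-symmetric d-ok _)))))
      (moved-at e v)

    -- Recolouring v with the colour of u instead of a different colour j frees j
    -- for the apex, unless j occurs elsewhere.
    free-gain : ∀ {u v} → u ≢ v → ∀ f →
      free (f [ v ]≔ σ u v (lookup f u)) + moved (u , v) (lookup f u)
      ≤ free (f [ v ]≔ lookup f u) + ∑[ z ← allFin k ] (moved (u , v) (lookup f u) * 𝟙 (lookup f z ≟ σ u v (lookup f u)))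
    free-gain {u} {v} u≢v f = begin
      free f₁ + μ
        -- The bonus is spread over the colours with all its weight at `j`, which reduces the claim
        -- to one inequality per colour.
        ≡⟨ cong (free f₁ +_) (∑-δ j (λ _ → μ)) ⟨
      free f₁ + ∑[ c ← allFin m ] (𝟙 (c ≟ j) * μ)
        ≡⟨ ∑-distrib-+ (allFin m) _ _ ⟨
      ∑[ c ← allFin m ] (𝟙 (avoids? f₁ c) + 𝟙 (c ≟ j) * μ)
        ≤⟨ ∑-mono (allFin m) pointwise ⟩
      ∑[ c ← allFin m ] (𝟙 (avoids? f₀ c) + 𝟙 (c ≟ j) * Z)
        ≡⟨ ∑-distrib-+ (allFin m) _ _ ⟩
      free f₀ + ∑[ c ← allFin m ] (𝟙 (c ≟ j) * Z)
        ≡⟨ cong (free f₀ +_) (∑-δ j (λ _ → Z)) ⟩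
      free f₀ + Z ∎
      where
      open ≤-Reasoning
      i = lookup f u
      j = σ u v i
      f₀ = f [ v ]≔ i
      f₁ = f [ v ]≔ j
      μ = moved (u , v) i
      Z = ∑[ z ← allFin k ] (μ * 𝟙 (lookup f z ≟ j))
      f₁⇒f₀ : ∀ c → Avoids f₁ c → Avoids f₀ c
      f₁⇒f₀ c av z eq with z ≟ v
      -- The colour `i` that `f₀` has at `v` occurs in `f₁` at `u`.
      ... | yes refl = av u (trans (lookup∘update′ u≢v f j) (trans (sym (lookup∘update v f i)) eq))
      ... | no  z≢v  = av z (trans (lookup∘update′ z≢v f j) (trans (sym (lookup∘update′ z≢v f i)) eq))
      key : μ ≤ 𝟙 (avoids? f₀ j) + Z
      key with any? (λ z → lookup f z ≟ j)
      ... | yes (z , fz≡j) = ≤-trans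
        (≤-trans (≤-reflexive (sym (trans (cong (μ *_) (𝟙-yes (lookup f z ≟ j) fz≡j)) (*-identityʳ μ))))
                 (∈⇒≤∑ (λ z → μ * 𝟙 (lookup f z ≟ j)) (∈-allFin z)))
        (m≤n+m Z _)
      ... | no ∄z = 𝟙≤ (¬? (j ≟ i)) λ j≢i → ≤-trans (1≤𝟙 (avoids? f₀ j) (avoid j≢i)) (m≤m+n _ Z)
        where
        avoid : j ≢ i → Avoids f₀ j
        avoid j≢i z eq with z ≟ v
        ... | yes refl = j≢i (trans (sym eq) (lookup∘update v f i))
        ... | no  z≢v  = ∄z (z , trans (sym (lookup∘update′ z≢v f i)) eq)
      pointwise : ∀ c → 𝟙 (avoids? f₁ c) + 𝟙 (c ≟ j) * μ ≤ 𝟙 (avoids? f₀ c) + 𝟙 (c ≟ j) * Z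
      pointwise c with c ≟ j
      -- Since `f₁` uses `j` at `v`, the left indicator vanishes and `key` remains.
      ... | yes refl = begin
        𝟙 (avoids? f₁ c) + 1 * μ ≡⟨ cong₂ _+_ (𝟙-no (avoids? f₁ c) (λ av → av v (lookup∘update v f j))) (+-identityʳ μ) ⟩
        μ                        ≤⟨ key ⟩
        𝟙 (avoids? f₀ c) + Z     ≡⟨ cong (𝟙 (avoids? f₀ c) +_) (+-identityʳ Z) ⟨
        𝟙 (avoids? f₀ c) + 1 * Z ∎
      ... | no _ = +-monoˡ-≤ 0 (𝟙-mono (avoids? f₁ c) (avoids? f₀ c) (f₁⇒f₀ c))

    ∑-conflict : ∀ (σ : Twist k m) {u v} → u ≢ v → ∀ (F : Vec (Fin m) k → ℕ) →
      m * (∑[ f ← Ω ] (𝟙 (conflict? σ f (u , v)) * F f)) ≡ ∑[ f ← Ω ] F (f [ v ]≔ σ u v (lookup f u))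
    ∑-conflict σ {u} {v} u≢v F = ∑-slice v (λ f → σ u v (lookup f u)) (λ f i → cong (σ u v) (lookup∘update′ u≢v f i)) F

    -- By `free-gain` a moved colour at `u` gains one free colour unless its image is hit elsewhere.
    -- The gains sum to `m * defect e`. Each of the `k` vertices hits the image with frequency at
    -- most `1 / m`, which loses at most `defect e`.
    single-bound : ∀ {e} → Loopless e →
      m * (m * (∑[ f ← Ω ] (𝟙 (conflict? σ f e) * free f))) + m * defect e
      ≤ m * (m * (∑[ f ← Ω ] (𝟙 (conflict? straight f e) * free f))) + k * defect e
    single-bound {e@(u , v)} u≢v = begin
      m * (m * (∑[ f ← Ω ] (𝟙 (conflict? σ f e) * free f))) + m * defect e
        ≡⟨ cong (λ s → m * s + m * defect e) (∑-conflict σ u≢v free) ⟩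
      m * (∑[ f ← Ω ] free (f [ v ]≔ σ u v (lookup f u))) + m * defect e
        ≡⟨ trans (sym (*-distribˡ-+ m _ _)) (cong (m *_) (sym (∑-distrib-+ Ω _ _))) ⟩
      m * (∑[ f ← Ω ] (free (f [ v ]≔ σ u v (lookup f u)) + moved e (lookup f u)))
        ≤⟨ *-monoʳ-≤ m (∑-mono Ω (free-gain u≢v)) ⟩
      m * (∑[ f ← Ω ] (free (f [ v ]≔ lookup f u) + ∑[ z ← allFin k ] hit z f))
        ≡⟨ trans (cong (m *_) (∑-distrib-+ Ω _ _)) (*-distribˡ-+ m _ _) ⟩
      m * (∑[ f ← Ω ] free (f [ v ]≔ lookup f u)) + m * (∑[ f ← Ω ] ∑[ z ← allFin k ] hit z f)
        ≡⟨ cong₂ (λ s t → m * s + t) (sym (∑-conflict straight u≢v free))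
             (trans (cong (m *_) (∑-swap Ω (allFin k) _)) (*-distribˡ-∑ (allFin k) m _)) ⟩
      m * (m * (∑[ f ← Ω ] (𝟙 (conflict? straight f e) * free f))) + ∑[ z ← allFin k ] (m * (∑[ f ← Ω ] hit z f))
        ≤⟨ +-monoʳ-≤ _ (∑-mono (allFin k) hits) ⟩
      m * (m * (∑[ f ← Ω ] (𝟙 (conflict? straight f e) * free f))) + ∑[ z ← allFin k ] defect e
        ≡⟨ cong (_ +_) (∑-const-allFin k (defect e)) ⟩
      m * (m * (∑[ f ← Ω ] (𝟙 (conflict? straight f e) * free f))) + k * defect e ∎
      where
      open ≤-Reasoning
      hit : Fin k → Vec (Fin m) k → ℕ
      hit z f = moved e (lookup f u) * 𝟙 (lookup f z ≟ σ u v (lookup f u))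
      hits : ∀ z → m * (∑[ f ← Ω ] hit z f) ≤ defect e
      hits z with u ≟ z
      ... | no  u≢z  = ∑-thin u≢z (moved e) id (σ u v)
      -- A moved colour differs from its image, so `u` itself never hits.
      ... | yes refl = ≤-trans (≤-reflexive (trans (cong (m *_) (trans (∑-cong Ω zero-hit) (∑-zero Ω))) (*-zeroʳ m))) z≤n
        where
        zero-hit : ∀ f → hit u f ≡ 0
        zero-hit f with σ u v (lookup f u) ≟ lookup f u
        ... | yes _ = refl
        ... | no ne = trans (+-identityʳ _) (𝟙-no (lookup f u ≟ σ u v (lookup f u)) (ne ∘ sym))

    -- Two edges in conflict at once.

    module Pair {u a u′ b : Fin k} (u≢a : u ≢ a) (u′≢b : u′ ≢ b) (a≢u′ : a ≢ u′) (b≢u : b ≢ u) (a≢b : a ≢ b) where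

      private
        e e′ : Edge k
        e = u , a
        e′ = u′ , b

      -- The heads `a` and `b` are distinct and neither is a tail, so the two overwritings do not
      -- interfere. The tails `u` and `u′` may coincide.
      impose : Twist k m → Vec (Fin m) k → Vec (Fin m) k
      impose ρ f = (f [ b ]≔ ρ u′ b (lookup f u′)) [ a ]≔ ρ u a (lookup f u)

      impose-a : ∀ ρ f → lookup (impose ρ f) a ≡ ρ u a (lookup f u)
      impose-a ρ f = lookup∘update a (f [ b ]≔ ρ u′ b (lookup f u′)) _

      impose-b : ∀ ρ f → lookup (impose ρ f) b ≡ ρ u′ b (lookup f u′)
      impose-b ρ f = trans (lookup∘update′ (a≢b ∘ sym) (f [ b ]≔ ρ u′ b (lookup f u′)) _) (lookup∘update b f _)

      impose-other : ∀ {x} → x ≢ a → x ≢ b → ∀ ρ f → lookup (impose ρ f) x ≡ lookup f x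
      impose-other x≢a x≢b ρ f = trans (lookup∘update′ x≢a (f [ b ]≔ ρ u′ b (lookup f u′)) _) (lookup∘update′ x≢b f _)

      -- Overwriting `a` touches neither end of `e′`, and overwriting `b` leaves the colour at `u`
      -- alone, so `∑-conflict` applies twice.
      ∑-conflict₂ : ∀ (ρ : Twist k m) (F : Vec (Fin m) k → ℕ) →
        m * (m * (∑[ f ← Ω ] (𝟙 (conflict? ρ f e) * (𝟙 (conflict? ρ f e′) * F f)))) ≡ ∑[ f ← Ω ] F (impose ρ f)
      ∑-conflict₂ ρ F = begin
        m * (m * (∑[ f ← Ω ] (𝟙 (conflict? ρ f e) * (𝟙 (conflict? ρ f e′) * F f))))
          ≡⟨ cong (m *_) (∑-conflict ρ u≢a _) ⟩
        m * (∑[ f ← Ω ] (𝟙 (conflict? ρ (f [ a ]≔ ρ u a (lookup f u)) e′) * F (f [ a ]≔ ρ u a (lookup f u))))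
          ≡⟨ cong (m *_) (∑-cong Ω (λ f → cong (_* F (f [ a ]≔ ρ u a (lookup f u)))
               (cong₂ (λ x y → 𝟙 (x ≟ ρ u′ b y)) (lookup∘update′ (a≢b ∘ sym) f _) (lookup∘update′ (a≢u′ ∘ sym) f _)))) ⟩
        m * (∑[ f ← Ω ] (𝟙 (conflict? ρ f e′) * F (f [ a ]≔ ρ u a (lookup f u))))
          ≡⟨ ∑-conflict ρ u′≢b _ ⟩
        ∑[ f ← Ω ] F ((f [ b ]≔ _) [ a ]≔ ρ u a (lookup (f [ b ]≔ _) u))
          ≡⟨ ∑-cong Ω (λ f → cong (λ x → F ((f [ b ]≔ _) [ a ]≔ ρ u a x)) (lookup∘update′ (b≢u ∘ sym) f _)) ⟩
        ∑[ f ← Ω ] F (impose ρ f) ∎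
        where open ≡-Reasoning

      -- After `impose`, every colour is a function of the original colour at one vertex: the tail
      -- for a head, the vertex itself otherwise. This treats all positions of a further edge
      -- relative to `e` and `e′` uniformly.
      record Trace (x : Fin k) : Set where
        field
          root     : Fin k
          τ        : Fin m → Fin m
          τ-inj    : Injective _≡_ _≡_ τ
          τ-moved  : ∀ i → τ i ≢ i → 1 ≤ moved e i + moved e′ i
          at-twisted  : ∀ f → lookup (impose σ f) x ≡ τ (lookup f root)
          at-straight : ∀ f → lookup (impose straight f) x ≡ lookup f root

      trace : ∀ x → Trace x
      trace x with x ≟ a
      ... | yes refl = record
        { root = u ; τ = σ u a ; τ-inj = σ-injective u≢a
        ; τ-moved = λ i ne → ≤-trans (1≤𝟙 (¬? (σ u a i ≟ i)) ne) (m≤m+n _ _)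
        ; at-twisted = impose-a σ
        ; at-straight = impose-a straight }
      ... | no x≢a with x ≟ b
      ...   | yes refl = record
        { root = u′ ; τ = σ u′ b ; τ-inj = σ-injective u′≢b
        ; τ-moved = λ i ne → ≤-trans (1≤𝟙 (¬? (σ u′ b i ≟ i)) ne) (m≤n+m _ _)
        ; at-twisted = impose-b σ
        ; at-straight = impose-b straight }
      ...   | no x≢b = record
        { root = x ; τ = id ; τ-inj = id
        ; τ-moved = λ i ne → ⊥-elim (ne refl)
        ; at-twisted = impose-other x≢a x≢b σ
        ; at-straight = impose-other x≢a x≢b straight }

      -- A conflict on `l` that twisting creates. Through such events the twisted sum loses
      -- colourings in the factor `none?`.
      Lost : Vec (Fin m) k → Edge k → Set
      Lost f l = Conflict σ (impose σ f) l × ¬ Conflict straight (impose straight f) l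

      lost? : ∀ f l → Dec (Lost f l)
      lost? f l = conflict? σ (impose σ f) l ×-dec ¬? (conflict? straight (impose straight f) l)

      -- If both ends of l have the same root, l closes a cycle with e and e′ and is in
      -- conflict for the straight twist anyway.  Otherwise losing l ties together the
      -- colours of two vertices, one of them moved by e, by e′ or by l.
      ∑-lost : ∀ l → Loopless l → m * (∑[ f ← Ω ] 𝟙 (lost? f l)) ≤ defect e + defect e′ + defect l
      ∑-lost l@(x , y) x≢y with Trace.root (trace x) ≟ Trace.root (trace y)
      ... | yes p≡q = ≤-trans (≤-reflexive (trans (cong (m *_) (trans (∑-cong Ω none-lost) (∑-zero Ω))) (*-zeroʳ m))) z≤n
        where
        none-lost : ∀ f → 𝟙 (lost? f l) ≡ 0
        none-lost f = 𝟙-no (lost? f l) λ (_ , ¬c) →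
          ¬c (trans (Trace.at-straight (trace y) f) (trans (cong (lookup f) (sym p≡q)) (sym (Trace.at-straight (trace x) f))))
      ... | no p≢q = begin
        m * (∑[ f ← Ω ] 𝟙 (lost? f l))
          ≤⟨ *-monoʳ-≤ m (∑-mono Ω pointwise) ⟩
        m * (∑[ f ← Ω ] (h (lookup f p) * 𝟙 (Y.τ (lookup f q) ≟ σ x y (X.τ (lookup f p)))))
          ≤⟨ ∑-thin p≢q h Y.τ-inj (σ x y ∘ X.τ) ⟩
        ∑[ f ← Ω ] h (lookup f p)
          ≡⟨ trans (∑-distrib-+ Ω _ _) (cong (_+ (∑[ f ← Ω ] moved l (lookup f p))) (∑-distrib-+ Ω _ _)) ⟩
        (∑[ f ← Ω ] moved e (lookup f p)) + (∑[ f ← Ω ] moved e′ (lookup f p)) + (∑[ f ← Ω ] moved l (lookup f p))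
          ≡⟨ cong₂ _+_ (cong₂ _+_ (moved-at e p) (moved-at e′ p)) (moved-at l p) ⟩
        defect e + defect e′ + defect l ∎
        where
        open ≤-Reasoning
        module X = Trace (trace x)
        module Y = Trace (trace y)
        p = X.root
        q = Y.root
        h : Fin m → ℕ
        h i = moved e i + moved e′ i + moved l i
        h-pos : ∀ f → Lost f l → 1 ≤ h (lookup f p)
        -- `Y.τ` is tested at the colour of `p`, not of `q`, so that `h` depends on one vertex only,
        -- as `∑-thin` requires.
        h-pos f (c , ¬c) with X.τ (lookup f p) ≟ lookup f p | σ x y (lookup f p) ≟ lookup f p | Y.τ (lookup f p) ≟ lookup f p
        ... | no  ne  | _       | _       = ≤-trans (X.τ-moved _ ne) (m≤m+n _ _)
        ... | yes _   | no ne   | _       = m≤n+m 1 _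
        ... | yes _   | yes _   | no ne   = ≤-trans (Y.τ-moved _ ne) (m≤m+n _ _)
        -- With nothing moved, the conflict reads `Y.τ (lookup f q) ≡ Y.τ (lookup f p)`, and
        -- injectivity yields a straight conflict.
        ... | yes eqX | yes eqσ | yes eqY = ⊥-elim (¬c (trans (Y.at-straight f) (trans fq≡fp (sym (X.at-straight f)))))
          where
          fq≡fp : lookup f q ≡ lookup f p
          fq≡fp = Y.τ-inj (trans (sym (Y.at-twisted f)) (trans c (trans (cong (σ x y) (trans (X.at-twisted f) eqX)) (trans eqσ (sym eqY)))))
        pointwise : ∀ f → 𝟙 (lost? f l) ≤ h (lookup f p) * 𝟙 (Y.τ (lookup f q) ≟ σ x y (X.τ (lookup f p)))
        pointwise f = 𝟙≤ (lost? f l) λ lost@(c , _) →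
          *-mono-≤ (h-pos f lost) (1≤𝟙 (Y.τ (lookup f q) ≟ _)
            (trans (sym (Y.at-twisted f)) (trans c (cong (σ x y) (X.at-twisted f)))))

      none-lost : ∀ f es → 𝟙 (none? straight (impose straight f) es) ≤ 𝟙 (none? σ (impose σ f) es) + ∑ es (𝟙 ∘ lost? f)
      none-lost f es = 𝟙≤ (none? straight (impose straight f) es) (go es)
        where
        go : ∀ es → All (¬_ ∘ Conflict straight (impose straight f)) es → 1 ≤ 𝟙 (none? σ (impose σ f) es) + ∑ es (𝟙 ∘ lost? f)
        go []       []         = ≤-refl
        go (l ∷ es) (¬c ∷ ¬cs) with conflict? σ (impose σ f) l
        ... | yes c = ≤-trans (1≤𝟙 (¬? (conflict? straight (impose straight f) l)) ¬c) (m≤m+n _ _)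
        ... | no  _ = go es ¬cs

      close : ∀ f z → lookup (impose σ f) z ≡ lookup (impose straight f) z
                    ⊎ lookup (impose σ f) z ≡ σ u a (lookup f u)
                    ⊎ lookup (impose σ f) z ≡ σ u′ b (lookup f u′)
      close f z with z ≟ a
      ... | yes refl = inj₂ (inj₁ (impose-a σ f))
      ... | no z≢a with z ≟ b
      ...   | yes refl = inj₂ (inj₂ (impose-b σ f))
      ...   | no z≢b = inj₁ (trans (impose-other z≢a z≢b σ f) (sym (impose-other z≢a z≢b straight f)))

      -- If neither colour is moved, the two substitutions coincide. Otherwise the bracket is at
      -- least 1 and pays for the two colours of `free-perturb`.
      free-impose : ∀ f → free (impose straight f) ≤ free (impose σ f) + 2 * (moved e (lookup f u) + moved e′ (lookup f u′))
      free-impose f with σ u a (lookup f u) ≟ lookup f u | σ u′ b (lookup f u′) ≟ lookup f u′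
      ... | yes eq | yes eq′ = ≤-trans (≤-reflexive (cong free (sym (cong₂ (λ i j → (f [ b ]≔ j) [ a ]≔ i) eq eq′)))) (m≤m+n _ _)
      ... | no _   | d       = ≤-trans (free-perturb (impose straight f) (impose σ f) (close f))
                                 (+-monoʳ-≤ (free (impose σ f)) (*-monoʳ-≤ 2 (s≤s z≤n)))
      ... | yes _  | no _    = free-perturb (impose straight f) (impose σ f) (close f)

    -- Scaled so that conditioning on two conflicts becomes the substitution `impose`.
    S : (Vec (Fin m) k → ℕ) → ℕ
    S F = m * (m * ∑ Ω F)

    S-cong : ∀ {F G} → F ≗ G → S F ≡ S G
    S-cong F≗G = cong (λ s → m * (m * s)) (∑-cong Ω F≗G)

    S-+ : ∀ F G → S (λ f → F f + G f) ≡ S F + S G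
    S-+ F G = trans (cong (λ s → m * (m * s)) (∑-distrib-+ Ω F G)) (expand m (∑ Ω F) (∑ Ω G))
      where
      expand : ∀ m x y → m * (m * (x + y)) ≡ m * (m * x) + m * (m * y)
      expand = solve-∀

    -- Error bounds for the quadratic terms.

    module Bounds (Δ : ℕ) where

      -- One bound `Δ` for all defects makes the error of a pair independent of the pair.
      Small : Edge k → Set
      Small e = Loopless e × defect e ≤ Δ

      -- There are two losses. Fewer free colours cost `2 * (Δ + Δ)` by `free-impose`. A lost edge
      -- may cost all of the at most `m` free colours, but `∑-lost` saves a factor `m`, which leaves
      -- `3 * Δ` for each edge of `es`.
      pair-bound-oriented : ∀ {u a u′ b es} → a ≢ u′ → b ≢ u → a ≢ b → Small (u , a) → Small (u′ , b) → All Small es →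
        S (λ f → 𝟙 (conflict? straight f (u , a)) * (𝟙 (conflict? straight f (u′ , b)) * (𝟙 (none? straight f es) * free f)))
        ≤ S (λ f → 𝟙 (conflict? σ f (u , a)) * (𝟙 (conflict? σ f (u′ , b)) * (𝟙 (none? σ f es) * free f)))
          + (4 + 3 * length es) * Δ
      pair-bound-oriented {u} {a} {u′} {b} {es} a≢u′ b≢u a≢b (u≢a , e≤T) (u′≢b , e′≤T) smalls = begin
        S (λ f → 𝟙 (conflict? straight f e) * (𝟙 (conflict? straight f e′) * (𝟙 (none? straight f es) * free f)))
          ≡⟨ ∑-conflict₂ straight _ ⟩
        ∑[ f ← Ω ] (𝟙 (none? straight (impose straight f) es) * free (impose straight f))
          ≤⟨ ∑-mono Ω pointwise ⟩
        ∑[ f ← Ω ] (𝟙 (none? σ (impose σ f) es) * free (impose σ f) + (2 * μ f + m * L f))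
          ≡⟨ trans (∑-distrib-+ Ω _ _) (cong (X +_) (∑-distrib-+ Ω _ _)) ⟩
        X + ((∑[ f ← Ω ] (2 * μ f)) + (∑[ f ← Ω ] (m * L f)))
          ≤⟨ +-mono-≤ (≤-reflexive (sym (∑-conflict₂ σ _))) (+-mono-≤ ∑-μ ∑-L) ⟩
        S (λ f → 𝟙 (conflict? σ f e) * (𝟙 (conflict? σ f e′) * (𝟙 (none? σ f es) * free f))) + (2 * (Δ + Δ) + length es * (Δ + Δ + Δ))
          ≡⟨ cong (S (λ f → 𝟙 (conflict? σ f e) * (𝟙 (conflict? σ f e′) * (𝟙 (none? σ f es) * free f))) +_) (collect Δ (length es)) ⟩
        S (λ f → 𝟙 (conflict? σ f e) * (𝟙 (conflict? σ f e′) * (𝟙 (none? σ f es) * free f))) + (4 + 3 * length es) * Δ ∎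
        where
        open ≤-Reasoning
        open Pair u≢a u′≢b a≢u′ b≢u a≢b
        e e′ : Edge k
        e = u , a
        e′ = u′ , b
        X = ∑[ f ← Ω ] (𝟙 (none? σ (impose σ f) es) * free (impose σ f))
        μ L : Vec (Fin m) k → ℕ
        μ f = moved e (lookup f u) + moved e′ (lookup f u′)
        L f = ∑ es (𝟙 ∘ lost? f)
        collect : ∀ Δ q → 2 * (Δ + Δ) + q * (Δ + Δ + Δ) ≡ (4 + 3 * q) * Δ
        collect = solve-∀
        pointwise : ∀ f → 𝟙 (none? straight (impose straight f) es) * free (impose straight f)
                        ≤ 𝟙 (none? σ (impose σ f) es) * free (impose σ f) + (2 * μ f + m * L f)
        pointwise f = begin
          𝟙 (none? straight (impose straight f) es) * free (impose straight f)
            ≤⟨ *-monoˡ-≤ (free (impose straight f)) (none-lost f es) ⟩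
          (ν + L f) * free (impose straight f)
            ≡⟨ *-distribʳ-+ (free (impose straight f)) ν (L f) ⟩
          ν * free (impose straight f) + L f * free (impose straight f)
            ≤⟨ +-mono-≤ (*-monoʳ-≤ ν (free-impose f)) (*-monoʳ-≤ (L f) (free≤m (impose straight f))) ⟩
          ν * (free (impose σ f) + 2 * μ f) + L f * m
            ≡⟨ regroup ν (free (impose σ f)) (2 * μ f) (L f) m ⟩
          ν * free (impose σ f) + (ν * (2 * μ f) + m * L f)
            ≤⟨ +-monoʳ-≤ (ν * free (impose σ f)) (+-monoˡ-≤ (m * L f)
                 (≤-trans (*-monoˡ-≤ (2 * μ f) (𝟙≤1 (none? σ (impose σ f) es))) (≤-reflexive (*-identityˡ _)))) ⟩
          ν * free (impose σ f) + (2 * μ f + m * L f) ∎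
          where
          ν = 𝟙 (none? σ (impose σ f) es)
          regroup : ∀ a b c d e → a * (b + c) + d * e ≡ a * b + (a * c + e * d)
          regroup = solve-∀
        ∑-μ : ∑[ f ← Ω ] (2 * μ f) ≤ 2 * (Δ + Δ)
        ∑-μ = begin
          ∑[ f ← Ω ] (2 * μ f)      ≡⟨ *-distribˡ-∑ Ω 2 μ ⟨
          2 * ∑ Ω μ                 ≡⟨ cong (2 *_) (∑-distrib-+ Ω _ _) ⟩
          2 * (defect e + defect e′) ≤⟨ *-monoʳ-≤ 2 (+-mono-≤ e≤T e′≤T) ⟩
          2 * (Δ + Δ)               ∎
        ∑-L : ∑[ f ← Ω ] (m * L f) ≤ length es * (Δ + Δ + Δ)
        ∑-L = begin
          ∑[ f ← Ω ] (m * L f)                       ≡⟨ *-distribˡ-∑ Ω m L ⟨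
          m * ∑ Ω L                                  ≡⟨ cong (m *_) (∑-swap Ω es _) ⟩
          m * (∑[ l ← es ] ∑[ f ← Ω ] 𝟙 (lost? f l)) ≡⟨ *-distribˡ-∑ es m _ ⟩
          ∑[ l ← es ] (m * ∑[ f ← Ω ] 𝟙 (lost? f l)) ≤⟨ ∑-bounded smalls (λ {l} (l-ok , l≤T) →
                                                          ≤-trans (∑-lost l l-ok) (+-mono-≤ (+-mono-≤ e≤T e′≤T) l≤T)) ⟩
          length es * (Δ + Δ + Δ)                    ∎

      -- Conflicts of symmetric twists and defects do not depend on the direction of an edge, so
      -- each edge may be turned until its head avoids the other edge.
      pair-bound : ∀ {e e′ es} → Distinct e e′ → Small e → Small e′ → All Small es →
        S (λ f → 𝟙 (conflict? straight f e) * (𝟙 (conflict? straight f e′) * (𝟙 (none? straight f es) * free f)))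
        ≤ S (λ f → 𝟙 (conflict? σ f e) * (𝟙 (conflict? σ f e′) * (𝟙 (none? σ f es) * free f)))
          + (4 + 3 * length es) * Δ
      pair-bound {e} {e′} {es} (e≢e′ , e≢e′ᵒ) (e-ok , e≤T) (e′-ok , e′≤T) smalls
        with orient e e′ e-ok (e≢e′ , e≢e′ᵒ) | orient e′ e e′-ok (e≢e′ ∘ sym , λ { refl → e≢e′ᵒ refl })
      ... | d@(u , a) , d~e , d-ok , a≢₁ , a≢₂ | d′@(u′ , b) , d′~e′ , d′-ok , b≢₁ , b≢₂ =
        subst (λ s → s ≤ S (term σ e e′) + (4 + 3 * length es) * Δ) (S-term straight straight-symmetric)
          (subst (λ s → S (term straight d d′) ≤ s + (4 + 3 * length es) * Δ) (S-term σ σ-symmetric)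
            (pair-bound-oriented (proj₁ (avoid d′~e′ a≢₁ a≢₂)) (proj₁ (avoid d~e b≢₁ b≢₂)) (proj₂ (avoid d′~e′ a≢₁ a≢₂))
              (d-ok , subst (_≤ Δ) (sym (defect-~ d~e d-ok)) e≤T)
              (d′-ok , subst (_≤ Δ) (sym (defect-~ d′~e′ d′-ok)) e′≤T) smalls))
        where
        term : Twist k m → Edge k → Edge k → Vec (Fin m) k → ℕ
        term ρ e e′ f = 𝟙 (conflict? ρ f e) * (𝟙 (conflict? ρ f e′) * (𝟙 (none? ρ f es) * free f))
        S-term : ∀ ρ → Symmetric ρ → S (term ρ d d′) ≡ S (term ρ e e′)
        S-term ρ sy = S-cong (λ f → cong₂ (λ x y → x * (y * (𝟙 (none? ρ f es) * free f)))
          (conflict-~ ρ sy d~e d-ok f) (conflict-~ ρ sy d′~e′ d′-ok f))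
        avoid : ∀ {c : Fin k} {d e} → d ~ e → c ≢ proj₁ e → c ≢ proj₂ e → c ≢ proj₁ d × c ≢ proj₂ d
        avoid (inj₁ refl) ≢₁ ≢₂ = ≢₁ , ≢₂
        avoid (inj₂ refl) ≢₁ ≢₂ = ≢₂ , ≢₁

      module _ (q : ℕ) where

        -- The error of a single pair, where `q` bounds the length of every tail that `none?` ranges
        -- over.
        unit : ℕ
        unit = (4 + 3 * q) * Δ

        -- Each summand of `first` is a conflict times `none?` of a tail, so it takes one
        -- application of `pair-bound`.
        first-bound : ∀ {e es} → length es ≤ q → All (Distinct e) es → Small e → All Small es →
          S (λ f → 𝟙 (conflict? straight f e) * (first straight f es * free f))
          ≤ S (λ f → 𝟙 (conflict? σ f e) * (first σ f es * free f)) + length es * unit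
        first-bound {e} {[]} _ [] _ [] = ≤-trans
          (≤-reflexive (S-cong (λ f → trans (*-zeroʳ (𝟙 (conflict? straight f e))) (sym (*-zeroʳ (𝟙 (conflict? σ f e)))))))
          (m≤m+n _ _)
        first-bound {e} {e′ ∷ es} es<q (e#e′ ∷ e#es) e-ok (e′-ok ∷ es-ok) = begin
          S (λ f → 𝟙 (conflict? straight f e) * (first straight f (e′ ∷ es) * free f))
            ≡⟨ split straight ⟩
          S (λ f → 𝟙 (conflict? straight f e) * (𝟙 (conflict? straight f e′) * (𝟙 (none? straight f es) * free f)))
          + S (λ f → 𝟙 (conflict? straight f e) * (first straight f es * free f))
            ≤⟨ +-mono-≤ (≤-trans (pair-bound e#e′ e-ok e′-ok es-ok)
                          (+-monoʳ-≤ X₁ (*-monoˡ-≤ Δ (+-monoʳ-≤ 4 (*-monoʳ-≤ 3 (<⇒≤ es<q))))))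
                        (first-bound (<⇒≤ es<q) e#es e-ok es-ok) ⟩
          (X₁ + unit) + (X₂ + length es * unit)
            ≡⟨ regroup X₁ unit X₂ (length es * unit) ⟩
          X₁ + X₂ + (unit + length es * unit)
            ≡⟨ cong (_+ (unit + length es * unit)) (split σ) ⟨
          S (λ f → 𝟙 (conflict? σ f e) * (first σ f (e′ ∷ es) * free f)) + (unit + length es * unit) ∎
          where
          open ≤-Reasoning
          X₁ = S (λ f → 𝟙 (conflict? σ f e) * (𝟙 (conflict? σ f e′) * (𝟙 (none? σ f es) * free f)))
          X₂ = S (λ f → 𝟙 (conflict? σ f e) * (first σ f es * free f))
          regroup : ∀ a b c d → (a + b) + (c + d) ≡ a + c + (b + d)
          regroup = solve-∀
          distribute : ∀ a b c d w → a * ((b * c + d) * w) ≡ a * (b * (c * w)) + a * (d * w)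
          distribute = solve-∀
          split : ∀ ρ → S (λ f → 𝟙 (conflict? ρ f e) * (first ρ f (e′ ∷ es) * free f))
                      ≡ S (λ f → 𝟙 (conflict? ρ f e) * (𝟙 (conflict? ρ f e′) * (𝟙 (none? ρ f es) * free f)))
                        + S (λ f → 𝟙 (conflict? ρ f e) * (first ρ f es * free f))
          split ρ = trans (S-cong (λ f → distribute (𝟙 (conflict? ρ f e)) (𝟙 (conflict? ρ f e′)) (𝟙 (none? ρ f es)) (first ρ f es) (free f))) (S-+ _ _)

        -- Every edge is combined with its tail by `first-bound`; at most `q * q` pairs contribute
        -- an error.
        pairs-bound : ∀ {es} → length es ≤ q → AllPairs Distinct es → All Small es →
          S (λ f → pairs straight f es * free f) ≤ S (λ f → pairs σ f es * free f) + length es * (q * unit)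
        pairs-bound {[]} _ [] [] = m≤m+n _ _
        pairs-bound {e ∷ es} es<q (e#es ∷ es#) (e-ok ∷ es-ok) = begin
          S (λ f → pairs straight f (e ∷ es) * free f)
            ≡⟨ split straight ⟩
          S (λ f → 𝟙 (conflict? straight f e) * (first straight f es * free f)) + S (λ f → pairs straight f es * free f)
            ≤⟨ +-mono-≤ (≤-trans (first-bound (<⇒≤ es<q) e#es e-ok es-ok) (+-monoʳ-≤ X₁ (*-monoˡ-≤ unit (<⇒≤ es<q))))
                        (pairs-bound (<⇒≤ es<q) es# es-ok) ⟩
          (X₁ + q * unit) + (X₂ + length es * (q * unit))
            ≡⟨ regroup X₁ (q * unit) X₂ (length es * (q * unit)) ⟩
          X₁ + X₂ + (q * unit + length es * (q * unit))
            ≡⟨ cong (_+ (q * unit + length es * (q * unit))) (split σ) ⟨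
          S (λ f → pairs σ f (e ∷ es) * free f) + (q * unit + length es * (q * unit)) ∎
          where
          open ≤-Reasoning
          X₁ = S (λ f → 𝟙 (conflict? σ f e) * (first σ f es * free f))
          X₂ = S (λ f → pairs σ f es * free f)
          regroup : ∀ a b c d → (a + b) + (c + d) ≡ a + c + (b + d)
          regroup = solve-∀
          distribute : ∀ a b c w → (a * b + c) * w ≡ a * (b * w) + c * w
          distribute = solve-∀
          split : ∀ ρ → S (λ f → pairs ρ f (e ∷ es) * free f)
                      ≡ S (λ f → 𝟙 (conflict? ρ f e) * (first ρ f es * free f)) + S (λ f → pairs ρ f es * free f)
          split ρ = trans (S-cong (λ f → distribute (𝟙 (conflict? ρ f e)) (first ρ f es) (pairs ρ f es) (free f))) (S-+ _ _)

    -- Comparison of the twisted and the straight sum.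

    singles-bound : ∀ {es} → All Loopless es →
      S (λ f → ∑ es (𝟙 ∘ conflict? σ f) * free f) + m * ∑ es defect
      ≤ S (λ f → ∑ es (𝟙 ∘ conflict? straight f) * free f) + k * ∑ es defect
    singles-bound {[]} [] = ≤-reflexive (cong (S (λ _ → 0) +_) (trans (*-zeroʳ m) (sym (*-zeroʳ k))))
    singles-bound {e ∷ es} (e-ok ∷ es-ok) = begin
      S (λ f → ∑ (e ∷ es) (𝟙 ∘ conflict? σ f) * free f) + m * (defect e + D)
        ≡⟨ cong₂ _+_ (split σ) (*-distribˡ-+ m (defect e) D) ⟩
      (X₁ σ + X₂ σ) + (m * defect e + m * D)
        ≡⟨ regroup (X₁ σ) (X₂ σ) _ _ ⟩
      (X₁ σ + m * defect e) + (X₂ σ + m * D)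
        ≤⟨ +-mono-≤ (single-bound e-ok) (singles-bound es-ok) ⟩
      (X₁ straight + k * defect e) + (X₂ straight + k * D)
        ≡⟨ regroup (X₁ straight) _ _ _ ⟩
      (X₁ straight + X₂ straight) + (k * defect e + k * D)
        ≡⟨ cong₂ _+_ (split straight) (*-distribˡ-+ k (defect e) D) ⟨
      S (λ f → ∑ (e ∷ es) (𝟙 ∘ conflict? straight f) * free f) + k * (defect e + D) ∎
      where
      open ≤-Reasoning
      D = ∑ es defect
      X₁ X₂ : Twist k m → ℕ
      X₁ ρ = S (λ f → 𝟙 (conflict? ρ f e) * free f)
      X₂ ρ = S (λ f → ∑ es (𝟙 ∘ conflict? ρ f) * free f)
      regroup : ∀ a b c d → (a + b) + (c + d) ≡ (a + c) + (b + d)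
      regroup = solve-∀
      split : ∀ ρ → S (λ f → ∑ (e ∷ es) (𝟙 ∘ conflict? ρ f) * free f) ≡ X₁ ρ + X₂ ρ
      split ρ = trans (S-cong (λ f → *-distribʳ-+ (free f) (𝟙 (conflict? ρ f e)) (∑ es (𝟙 ∘ conflict? ρ f)))) (S-+ _ _)

    -- By `none+∑` each count is governed by its linear and quadratic terms. The linear terms gain
    -- `m * Δ` and lose `k * Δ`; the quadratic ones lose `q * (q * (4 + 3 * q)) * Δ`. The bound on
    -- `m` lets the gain cover both losses.
    straight-minimal : ∀ {es} → All Loopless es → AllPairs Distinct es →
      k + length es * (length es * (4 + 3 * length es)) ≤ m →
      ∑[ f ← Ω ] (𝟙 (none? straight f es) * free f) ≤ ∑[ f ← Ω ] (𝟙 (none? σ f es) * free f)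
    -- Adding the linear terms of both twists to both sides replaces the subtractions of the
    -- expansion. Cancelling `m` twice removes the scaling of `S`.
    straight-minimal {es} es-ok es# m-large = *-cancelˡ-≤ m (*-cancelˡ-≤ m (+-cancelʳ-≤ (Ys + Xs + m * Δ) _ _ (begin
      Yn + (Ys + Xs + m * Δ)                ≡⟨ regroup₁ Yn Ys Xs (m * Δ) ⟩
      (Yn + Ys) + (Xs + m * Δ)              ≡⟨ cong (_+ (Xs + m * Δ)) (expansion straight) ⟩
      (Z + Yp) + (Xs + m * Δ)               ≤⟨ +-mono-≤ (+-monoʳ-≤ Z (pairs-bound q ≤-refl es# es-small)) (singles-bound es-ok) ⟩
      (Z + (Xp + q * (q * unit q))) + (Ys + k * Δ) ≡⟨ regroup₂ Z Xp q Ys k Δ ⟩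
      (Z + Xp) + (Ys + (k + q * (q * (4 + 3 * q))) * Δ) ≤⟨ +-monoʳ-≤ (Z + Xp) (+-monoʳ-≤ Ys (*-monoˡ-≤ Δ m-large)) ⟩
      (Z + Xp) + (Ys + m * Δ)               ≡⟨ cong (_+ (Ys + m * Δ)) (expansion σ) ⟨
      (Xn + Xs) + (Ys + m * Δ)              ≡⟨ regroup₃ Xn Xs Ys (m * Δ) ⟩
      Xn + (Ys + Xs + m * Δ)                ∎)))
      where
      open ≤-Reasoning
      q = length es
      -- The sum measures the total gain of the linear terms and also bounds every single defect.
      Δ = ∑ es defect
      open Bounds Δ
      Z = S free
      Yn = S (λ f → 𝟙 (none? straight f es) * free f)
      Ys = S (λ f → ∑ es (𝟙 ∘ conflict? straight f) * free f)
      Yp = S (λ f → pairs straight f es * free f)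
      Xn = S (λ f → 𝟙 (none? σ f es) * free f)
      Xs = S (λ f → ∑ es (𝟙 ∘ conflict? σ f) * free f)
      Xp = S (λ f → pairs σ f es * free f)
      es-small : All Small es
      es-small = All.tabulate (λ e∈ → All.lookup es-ok e∈ , ∈⇒≤∑ defect e∈)
      expansion : ∀ ρ → S (λ f → 𝟙 (none? ρ f es) * free f) + S (λ f → ∑ es (𝟙 ∘ conflict? ρ f) * free f)
                      ≡ Z + S (λ f → pairs ρ f es * free f)
      expansion ρ = trans (sym (S-+ _ _)) (trans (S-cong (λ f → trans (sym (*-distribʳ-+ (free f) (𝟙 (none? ρ f es)) _))
        (cong (_* free f) (none+∑ ρ f es)))) (S-+ free _))
      regroup₁ : ∀ a b c d → a + (b + c + d) ≡ (a + b) + (c + d)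
      regroup₁ = solve-∀
      regroup₂ : ∀ z x q y k Δ → (z + (x + q * (q * ((4 + 3 * q) * Δ)))) + (y + k * Δ) ≡ (z + x) + (y + (k + q * (q * (4 + 3 * q))) * Δ)
      regroup₂ = solve-∀
      regroup₃ : ∀ a b c d → (a + b) + (c + d) ≡ a + (c + b + d)
      regroup₃ = solve-∀

-- Counting by injections

-- The head of `xs` is cut out of `ys`, and uniqueness keeps the rest of `xs` inside what remains.
-- Counts of independent sets are compared through this from both sides.
length-≤ : ∀ {xs ys : List A} → Unique xs → (∀ {x} → x ∈ xs → x ∈ ys) → length xs ≤ length ys
length-≤ []         _     = z≤n
length-≤ {xs = x ∷ xs} (x∉xs ∷ xs!) xs⊆ys with ∈-∃++ (xs⊆ys (here refl))
... | as , bs , refl = ≤-trans (s≤s (length-≤ xs! xs⊆as++bs)) (≤-reflexive (sym length-insert))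
  where
  length-insert : length (as ++ x ∷ bs) ≡ suc (length (as ++ bs))
  length-insert = trans (length-++ as) (trans (+-suc _ _) (cong suc (sym (length-++ as))))
  xs⊆as++bs : ∀ {z} → z ∈ xs → z ∈ as ++ bs
  xs⊆as++bs z∈xs with ∈-++⁻ as (xs⊆ys (there z∈xs))
  ... | inj₁ z∈as         = ∈-++⁺ˡ z∈as
  ... | inj₂ (here refl)  = ⊥-elim (All.lookup x∉xs z∈xs refl)
  ... | inj₂ (there z∈bs) = ∈-++⁺ʳ as z∈bs

length-filter : ∀ {R : A → Set} (r? : ∀ x → Dec (R x)) xs → length (filter r? xs) ≡ ∑ xs (𝟙 ∘ r?)
length-filter r? []       = refl
length-filter r? (x ∷ xs) with does (r? x)
... | true  = cong suc (length-filter r? xs)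
... | false = length-filter r? xs

lookup-injective : ∀ {xs : List A} → Unique xs → Injective _≡_ _≡_ (Data.List.lookup xs)
lookup-injective {xs = x ∷ xs} (_ ∷ _)    {zero}  {zero}  eq = refl
lookup-injective {xs = x ∷ xs} (x∉ ∷ _)   {zero}  {suc j} eq = ⊥-elim (All.lookup x∉ (∈-lookup j) eq)
lookup-injective {xs = x ∷ xs} (x∉ ∷ _)   {suc i} {zero}  eq = ⊥-elim (All.lookup x∉ (∈-lookup i) (sym eq))
lookup-injective {xs = x ∷ xs} (_ ∷ xs!)  {suc i} {suc j} eq = cong suc (lookup-injective xs! eq)

allVecs-unique : ∀ k m → Unique (allVecs k m)
allVecs-unique zero    m = [] ∷ []
allVecs-unique (suc k) m = cartesianProductWith⁺ _ (λ eq → proj₂ (∷-injective eq) , proj₁ (∷-injective eq)) (allVecs-unique k m) (allFin⁺ m)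

∈-allVecs : ∀ {k m} (f : Vec (Fin m) k) → f ∈ allVecs k m
∈-allVecs []      = here refl
∈-allVecs (c ∷ f) = ∈-cartesianProductWith⁺ (λ f c → c ∷ f) (∈-allVecs f) (∈-allFin c)

bits : List Bool
bits = true ∷ false ∷ []

∈-bits : ∀ b → b ∈ bits
∈-bits true  = here refl
∈-bits false = there (here refl)

-- As a product of lists, the enumeration inherits uniqueness and completeness from
-- `cartesianProductWith`.
allSubsets-suc : ∀ k → allSubsets (suc k) ≡ cartesianProductWith (λ s b → b ∷ s) (allSubsets k) bits
allSubsets-suc k = go (allSubsets k)
  where
  go : ∀ ss → concatMap (λ s → (true ∷ s) ∷ (false ∷ s) ∷ []) ss ≡ cartesianProductWith (λ s b → b ∷ s) ss bits
  go []       = refl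
  go (s ∷ ss) = cong (λ z → (true ∷ s) ∷ (false ∷ s) ∷ z) (go ss)

allSubsets-unique : ∀ k → Unique (allSubsets k)
allSubsets-unique zero    = [] ∷ []
allSubsets-unique (suc k) = subst Unique (sym (allSubsets-suc k))
  (cartesianProductWith⁺ _ (λ eq → proj₂ (∷-injective eq) , proj₁ (∷-injective eq)) (allSubsets-unique k)
    (((λ ()) ∷ []) ∷ [] ∷ []))

∈-allSubsets : ∀ {k} (s : Subset k) → s ∈ allSubsets k
∈-allSubsets []      = here refl
∈-allSubsets (b ∷ s) = subst ((b ∷ s) ∈_) (sym (allSubsets-suc _))
  (∈-cartesianProductWith⁺ (λ s b → b ∷ s) (∈-allSubsets s) (∈-bits b))

members : ∀ {k} → Subset k → List (Fin k)
members {k} s = filter (T? ∘ lookup s) (allFin k)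

∣∣≡length-members : ∀ {k} (s : Subset k) → ∣ s ∣ ≡ length (members s)
∣∣≡length-members {k} s = trans (go s id (⟦_⟧ ∘ lookup s) (λ _ → refl)) (sym (length-filter (T? ∘ lookup s) (allFin k)))
  where
  -- Since `allFin` is a `tabulate`, the induction runs over an arbitrary tabulated function.
  go : ∀ {k} {A : Set} (s : Subset k) (g : Fin k → A) (F : A → ℕ) → (∀ i → F (g i) ≡ ⟦ lookup s i ⟧) → ∣ s ∣ ≡ ∑ (tabulate g) F
  go []          g F h = refl
  go (true  ∷ s) g F h = cong₂ _+_ (sym (h zero)) (go s (g ∘ suc) F (h ∘ suc))
  go (false ∷ s) g F h = cong₂ _+_ (sym (h zero)) (go s (g ∘ suc) F (h ∘ suc))

-- Proper colourings and independent sets as propositions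

T⇒≡ : ∀ {b} → T b → b ≡ true
T⇒≡ = Equivalence.to T-≡

≡⇒T : ∀ {b} → b ≡ true → T b
≡⇒T = Equivalence.from T-≡

allᵇ⁻ : ∀ {k} {p : Fin k → Bool} → T (allᵇ p) → ∀ i → T (p i)
allᵇ⁻ {k} {p} t i = go (allFin k) t (∈-allFin i)
  where
  go : ∀ xs → T (foldr (λ i b → p i ∧ b) true xs) → i ∈ xs → T (p i)
  go (x ∷ xs) t (here refl) = proj₁ (Equivalence.to T-∧ t)
  go (x ∷ xs) t (there i∈)  = go xs (proj₂ (Equivalence.to (T-∧ {p x}) t)) i∈

allᵇ⁺ : ∀ {k} {p : Fin k → Bool} → (∀ i → T (p i)) → T (allᵇ p)
allᵇ⁺ {k} {p} h = go (allFin k)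
  where
  go : ∀ xs → T (foldr (λ i b → p i ∧ b) true xs)
  go []       = _
  go (x ∷ xs) = Equivalence.from T-∧ (h x , go xs)

not∧⁻ : ∀ {a b} → T (not (a ∧ b)) → T a → ¬ T b
not∧⁻ {true} {true} ()

not∧⁺ : ∀ {a b} → (T a → ¬ T b) → T (not (a ∧ b))
not∧⁺ {false}         h = _
not∧⁺ {true}  {false} h = _
not∧⁺ {true}  {true}  h = h _ _

proper⁻ : ∀ G {m} {f : Fin (n G) → Fin m} → T (proper G f) → ∀ u v → adj G u v ≡ true → f u ≢ f v
proper⁻ G t u v e fu≡fv = not∧⁻ {adj G u v} (allᵇ⁻ (allᵇ⁻ t u) v) (≡⇒T e) (fromWitness fu≡fv)

proper⁺ : ∀ G {m} {f : Fin (n G) → Fin m} → (∀ u v → adj G u v ≡ true → f u ≢ f v) → T (proper G f)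
proper⁺ G h = allᵇ⁺ λ u → allᵇ⁺ λ v → not∧⁺ {adj G u v} λ e eq → h u v (T⇒≡ e) (toWitness eq)

proper? : ∀ G {m} (f : Fin (n G) → Fin m) → Dec (T (proper G f))
proper? G f = T? (proper G f)

P≡∑ : ∀ G m → P G m ≡ ∑[ f ← allVecs (n G) m ] 𝟙 (proper? G (lookup f))
P≡∑ G m = trans (length-filter (proper? G) (allFuns (n G) m)) (∑-allFuns (n G) m (𝟙 ∘ proper? G)
  (λ {f} {g} f≗g → 𝟙-cong (proper? G f) (proper? G g)
    (λ t → proper⁺ G (λ u v e eq → proper⁻ G t u v e (trans (f≗g u) (trans eq (sym (f≗g v))))))
    (λ t → proper⁺ G (λ u v e eq → proper⁻ G t u v e (trans (sym (f≗g u)) (trans eq (f≗g v)))))))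

independent⁻ : ∀ {G m} (C : Cover G m) s → T (independent C s) →
               ∀ x y → T (lookup s x) → T (lookup s y) → adjH C x y ≢ true
independent⁻ C s t x y x∈ y∈ e =
  not∧⁻ {lookup s x} (allᵇ⁻ (allᵇ⁻ t x) y) x∈ (Equivalence.from T-∧ (y∈ , ≡⇒T e))

independent⁺ : ∀ {G m} (C : Cover G m) s →
               (∀ x y → T (lookup s x) → T (lookup s y) → adjH C x y ≢ true) → T (independent C s)
independent⁺ C s h = allᵇ⁺ λ x → allᵇ⁺ λ y → not∧⁺ {lookup s x} λ x∈ yxy →
  let y∈ , e = Equivalence.to (T-∧ {lookup s y}) yxy in h x y x∈ y∈ (T⇒≡ e)

-- Transversals of a cover

-- Names the vertices of each list by colours. As every list has `m` elements, injectivity already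
-- makes `ι u` a bijection onto it.
record Labelling {G m} (C : Cover G m) : Set where
  field
    ι       : Fin (n G) → Fin m → Fin (N C)
    owner-ι : ∀ u i → owner C (ι u i) ≡ u
    ι-inj   : ∀ u → Injective _≡_ _≡_ (ι u)

  transversal : Vec (Fin m) (n G) → Subset (N C)
  transversal f = Vec.tabulate (λ x → ⌊ x ≟ ι (owner C x) (lookup f (owner C x)) ⌋)

  ∈-transversal⁻ : ∀ f {x} → T (lookup (transversal f) x) → x ≡ ι (owner C x) (lookup f (owner C x))
  ∈-transversal⁻ f {x} t = toWitness (subst T (lookup∘tabulate _ x) t)

  ∈-transversal⁺ : ∀ f {x} → x ≡ ι (owner C x) (lookup f (owner C x)) → T (lookup (transversal f) x)
  ∈-transversal⁺ f {x} eq = subst T (sym (lookup∘tabulate _ x)) (fromWitness eq)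

  ι∈transversal : ∀ f u → T (lookup (transversal f) (ι u (lookup f u)))
  ι∈transversal f u = ∈-transversal⁺ f (cong (λ v → ι v (lookup f v)) (sym (owner-ι u _)))

  transversal-injective : Injective _≡_ _≡_ transversal
  transversal-injective {f} {g} eq = trans (sym (tabulate∘lookup f)) (trans (tabulate-cong pointwise) (tabulate∘lookup g))
    where
    pointwise : ∀ u → lookup f u ≡ lookup g u
    pointwise u = ι-inj u (trans (∈-transversal⁻ g (subst (λ s → T (lookup s _)) eq (ι∈transversal f u)))
                                 (cong (λ v → ι v (lookup g v)) (owner-ι u _)))

  ∣transversal∣ : ∀ f → ∣ transversal f ∣ ≡ n G
  ∣transversal∣ f = trans (∣∣≡length-members s) (trans (≤-antisym
      (length-≤ (filter⁺ (T? ∘ lookup s) (allFin⁺ (N C))) members⊆points)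
      (length-≤ (map⁺ point-inj (allFin⁺ (n G))) points⊆members))
    (trans (length-map point (allFin (n G))) (length-tabulate {n = n G} id)))
    where
    s = transversal f
    point : Fin (n G) → Fin (N C)
    point u = ι u (lookup f u)
    point-inj : Injective _≡_ _≡_ point
    point-inj {u} {v} eq = trans (sym (owner-ι u _)) (trans (cong (owner C) eq) (owner-ι v _))
    members⊆points : ∀ {x} → x ∈ members s → x ∈ map point (allFin (n G))
    members⊆points {x} x∈ = subst (_∈ _) (sym (∈-transversal⁻ f (proj₂ (∈-filter⁻ (T? ∘ lookup s) {xs = allFin (N C)} x∈))))
      (∈-map⁺ point (∈-allFin (owner C x)))
    points⊆members : ∀ {x} → x ∈ map point (allFin (n G)) → x ∈ members s
    points⊆members x∈ with ∈-map⁻ point x∈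
    ... | u , _ , refl = ∈-filter⁺ (T? ∘ lookup s) (∈-allFin _) (ι∈transversal f u)

  NonAdjacent : Vec (Fin m) (n G) → Set
  NonAdjacent f = ∀ u v → u ≢ v → adjH C (ι u (lookup f u)) (ι v (lookup f v)) ≢ true

  transversal-independent : ∀ f → NonAdjacent f → T (independent C (transversal f))
  transversal-independent f na = independent⁺ C (transversal f) λ x y x∈ y∈ e →
    let x≡ = ∈-transversal⁻ f x∈
        y≡ = ∈-transversal⁻ f y∈ in
    na (owner C x) (owner C y)
      -- Members with equal owners coincide, so their adjacency would be a loop.
      (λ o≡ → false≢true (trans (sym (adjH-irr C x))
        (trans (cong (adjH C x) (trans x≡ (trans (cong (λ v → ι v (lookup f v)) o≡) (sym y≡)))) e)))
      (trans (sym (cong₂ (adjH C) x≡ y≡)) e)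
    where
    false≢true : false ≢ true
    false≢true ()

  -- `transversal` injects the colour vectors into the independent sets counted. `R` may be stricter
  -- than `NonAdjacent`: permutations that complete the matchings can forbid colourings that the
  -- cover allows.
  colourings≤PDPcover : ∀ {R : Vec (Fin m) (n G) → Set} (r? : ∀ f → Dec (R f)) → (∀ f → R f → NonAdjacent f) →
                        ∑ (allVecs (n G) m) (𝟙 ∘ r?) ≤ PDPcover C
  colourings≤PDPcover {R} r? h = begin
    ∑ (allVecs (n G) m) (𝟙 ∘ r?)
      ≡⟨ length-filter r? (allVecs (n G) m) ⟨
    length (filter r? (allVecs (n G) m))
      ≡⟨ length-map transversal (filter r? (allVecs (n G) m)) ⟨
    length (map transversal (filter r? (allVecs (n G) m)))
      ≤⟨ length-≤ (map⁺ transversal-injective (filter⁺ r? (allVecs-unique (n G) m))) included ⟩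
    PDPcover C ∎
    where
    open ≤-Reasoning
    included : ∀ {s} → s ∈ map transversal (filter r? (allVecs (n G) m)) →
               s ∈ filterᵇ (λ s → (∣ s ∣ ≡ᵇ n G) ∧ independent C s) (allSubsets (N C))
    included s∈ with ∈-map⁻ transversal s∈
    ... | f , f∈ , refl = ∈-filter⁺ _ (∈-allSubsets _)
      (Equivalence.from T-∧ (≡⇒≡ᵇ _ _ (∣transversal∣ f) , transversal-independent f (h f (proj₂ (∈-filter⁻ r? {xs = allVecs (n G) m} f∈)))))

labelling : ∀ {G m} (C : Cover G m) → Labelling C
labelling {G} {m} C = record { ι = proj₁ ∘ list ; owner-ι = proj₁ ∘ proj₂ ∘ list ; ι-inj = λ u → proj₂ (proj₂ (list u)) }
  where
  list : ∀ u → Σ (Fin m → Fin (N C)) λ g → (∀ i → owner C (g i) ≡ u) × Injective _≡_ _≡_ g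
  list u = go (fold C u)
    where
    p? = λ x → T? ⌊ owner C x ≟ u ⌋
    xs = filter p? (allFin (N C))
    -- Generalised over `m`, so that matching on the equation identifies colours with positions in
    -- the list.
    go : ∀ {m} → length xs ≡ m → Σ (Fin m → Fin (N C)) λ g → (∀ i → owner C (g i) ≡ u) × Injective _≡_ _≡_ g
    go refl = Data.List.lookup xs
            , (λ i → toWitness (proj₂ (∈-filter⁻ p? {xs = allFin (N C)} (∈-lookup i))))
            , lookup-injective (filter⁺ p? (allFin⁺ (N C)))

-- Straightening the matchings

module _ {m} {M : Fin m → Fin m → Set} (M? : ∀ i j → Dec (M i j))
         (functional : ∀ {i j j′} → M i j → M i j′ → j ≡ j′) (injective : ∀ {i i′ j} → M i j → M i′ j → i ≡ i′) where

  -- Rows are treated one at a time: to give `r` its partner `c`, the values of `r` and of the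
  -- preimage `r′` of `c` are exchanged. Rows without a partner accept any value.
  extend-matching : Σ (Permutation′ m) λ π → ∀ {i j} → M i j → π ⟨$⟩ʳ i ≡ j
  extend-matching = let π , π-ok = go (allFin m) in π , π-ok (∈-allFin _)
    where
    go : ∀ rows → Σ (Permutation′ m) λ π → ∀ {i j} → i ∈ rows → M i j → π ⟨$⟩ʳ i ≡ j
    go [] = idₚ , λ ()
    go (r ∷ rows) with go rows | any? (M? r)
    ... | π , π-ok | no ∄j = π , λ { (here refl) Mij → ⊥-elim (∄j (_ , Mij)) ; (there i∈) → π-ok i∈ }
    ... | π , π-ok | yes (c , Mrc) = transpose r r′ ∘ₚ π , ok
      where
      r′ = π ⟨$⟩ˡ c
      ok : ∀ {i j} → i ∈ r ∷ rows → M i j → transpose r r′ ∘ₚ π ⟨$⟩ʳ i ≡ j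
      ok {i} i∈ Mij with i ≟ r
      ... | yes refl = trans (inverseʳ π) (functional Mrc Mij)
      ok (here i≡r) Mij | no i≢r = ⊥-elim (i≢r i≡r)
      ok {i} (there i∈) Mij | no i≢r with i ≟ r′
      ... | no _     = π-ok i∈ Mij
      -- If `r′` had a partner, it would be `c`, which belongs to `r`.
      ... | yes refl = ⊥-elim (i≢r (injective Mij (subst (M r) (trans (sym (inverseʳ π)) (π-ok i∈ Mij)) Mrc)))

-- The matching condition, read from both ends, makes adjacency between two lists a partial
-- injection. The identity is a default for equal vertices.
align : ∀ {G m} {C : Cover G m} (L : Labelling C) → let open Labelling L in ∀ u v →
        Σ (Permutation′ m) λ π → u ≢ v → ∀ {i j} → adjH C (ι u i) (ι v j) ≡ true → π ⟨$⟩ʳ i ≡ j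
align {C = C} L u v with u ≟ v
... | yes u≡v = idₚ , λ u≢v → ⊥-elim (u≢v u≡v)
... | no  u≢v = let π , π-ok = extend-matching (λ i j → adjH C (ι u i) (ι v j) ≟ᵇ true)
                      (λ e e′ → ι-inj v (matching C _ _ _ e e′ (same v) (differ u≢v)))
                      (λ e e′ → ι-inj u (matching C _ _ _ (flip e) (flip e′) (same u) (differ (u≢v ∘ sym))))
                in π , λ _ → π-ok
  where
  open Labelling L
  same : ∀ v {i j} → owner C (ι v i) ≡ owner C (ι v j)
  same v = trans (owner-ι v _) (sym (owner-ι v _))
  differ : ∀ {u v i j} → u ≢ v → owner C (ι u i) ≢ owner C (ι v j)
  differ u≢v eq = u≢v (trans (sym (owner-ι _ _)) (trans eq (owner-ι _ _)))
  flip : ∀ {x y} → adjH C x y ≡ true → adjH C y x ≡ true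
  flip e = trans (adjH-sym C _ _) e

module _ {G : Graph} {m : ℕ} (C : Cover (cone G) m) where

  private
    module L₀ = Labelling (labelling C)

    spoke : Fin (n G) → Permutation′ m
    spoke v = proj₁ (align (labelling C) zero (suc v))

  -- Colours at `v` are renamed along the completed matching to the apex. Afterwards the apex is
  -- joined to equal colours only, which is why it can contribute the factor `free`.
  straightened : Labelling C
  straightened = record
    { ι       = λ { zero → L₀.ι zero ; (suc v) → L₀.ι (suc v) ∘ (spoke v ⟨$⟩ʳ_) }
    ; owner-ι = λ { zero → L₀.owner-ι zero ; (suc v) i → L₀.owner-ι (suc v) _ }
    ; ι-inj   = λ { zero → L₀.ι-inj zero
                  ; (suc v) eq → trans (sym (inverseˡ (spoke v))) (trans (cong (spoke v ⟨$⟩ˡ_) (L₀.ι-inj (suc v) eq)) (inverseˡ (spoke v))) }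
    }

  open Labelling straightened

  apex-straight : ∀ v {i j} → adjH C (ι zero i) (ι (suc v) j) ≡ true → i ≡ j
  apex-straight v e = trans (sym (inverseˡ (spoke v)))
    (trans (cong (spoke v ⟨$⟩ˡ_) (proj₂ (align (labelling C) zero (suc v)) (λ ()) e)) (inverseˡ (spoke v)))

  private
    π : Fin (n G) → Fin (n G) → Permutation′ m
    π u v = proj₁ (align straightened (suc u) (suc v))

  -- Symmetry is built in by inverting the permutations of increasing pairs; independent completions
  -- for `u , v` and `v , u` need not be inverse to each other.
  twist : Twist (n G) m
  twist u v with <-cmp u v
  ... | tri< _ _ _ = π u v ⟨$⟩ʳ_
  ... | tri≈ _ _ _ = id
  ... | tri> _ _ _ = π v u ⟨$⟩ˡ_

  twist-symmetric : Symmetric twist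
  twist-symmetric {u} {v} u≢v i with <-cmp u v | <-cmp v u
  ... | tri< u<v _ _ | tri< v<u _ _ = ⊥-elim (<-asym u<v v<u)
  ... | tri< _ _ _   | tri> _ _ _   = inverseˡ (π u v)
  ... | tri> _ _ _   | tri< _ _ _   = inverseʳ (π v u)
  ... | tri> _ _ v<u | tri> _ _ u<v = ⊥-elim (<-asym u<v v<u)
  ... | tri≈ _ u≡v _ | _            = ⊥-elim (u≢v u≡v)
  ... | _            | tri≈ _ v≡u _ = ⊥-elim (u≢v (sym v≡u))

  twist-spec : ∀ {u v} → u < v → ∀ {i j} → adjH C (ι (suc u) i) (ι (suc v) j) ≡ true → j ≡ twist u v i
  twist-spec {u} {v} u<v e with <-cmp u v
  ... | tri< _ u≢v _ = sym (proj₂ (align straightened (suc u) (suc v)) (λ { refl → u≢v refl }) e)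
  ... | tri≈ u≮v _ _ = ⊥-elim (u≮v u<v)
  ... | tri> u≮v _ _ = ⊥-elim (u≮v u<v)

-- Edge lists and the lower bound for all covers.

edges : (G : Graph) → List (Edge (n G))
edges G = filter (λ (u , v) → (u <? v) ×-dec (adj G u v ≟ᵇ true)) (cartesianProduct (allFin (n G)) (allFin (n G)))

∈-edges⁻ : ∀ G {u v} → (u , v) ∈ edges G → u < v × adj G u v ≡ true
∈-edges⁻ G e∈ = proj₂ (∈-filter⁻ _ {xs = cartesianProduct (allFin (n G)) (allFin (n G))} e∈)

∈-edges⁺ : ∀ G {u v} → u < v → adj G u v ≡ true → (u , v) ∈ edges G
∈-edges⁺ G u<v e = ∈-filter⁺ _ (∈-cartesianProduct⁺ (∈-allFin _) (∈-allFin _)) (u<v , e)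

edges-loopless : ∀ G → All Loopless (edges G)
edges-loopless G = All.tabulate λ e∈ u≡v → <-irrefl u≡v (proj₁ (∈-edges⁻ G e∈))

-- Listed pairs are increasing, so none is the reverse of another.
edges-distinct : ∀ G → AllPairs Distinct (edges G)
edges-distinct G = go (All.tabulate (proj₁ ∘ ∈-edges⁻ G))
  (filter⁺ _ (cartesianProduct⁺ (allFin⁺ (n G)) (allFin⁺ (n G))))
  where
  go : ∀ {es : List (Edge (n G))} → All (λ (u , v) → u < v) es → Unique es → AllPairs Distinct es
  go []           []           = []
  go (e< ∷ es<) (e∉ ∷ es!) =
    All.map (λ (e′< , e≢e′) → e≢e′ , λ { refl → <-asym e< e′< }) (All.zip (es< , e∉)) ∷ go es< es!

-- The bound on `m` in `straight-minimal`. Only edges of `G` are counted, because those at the apex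
-- are absorbed by `free`.
threshold : Graph → ℕ
threshold G = n G + length (edges G) * (length (edges G) * (4 + 3 * length (edges G)))

-- The head of a colour vector is the colour of the apex; summing over it turns the condition
-- `Avoids` into the factor `free f`, and `straight-minimal` compares the resulting sums.
P≤PDPcover : ∀ G {m} → threshold G ≤ m → (C : Cover (cone G) m) → P (cone G) m ≤ PDPcover C
P≤PDPcover G {m} m-large C = begin
  P (cone G) m
    ≡⟨ P≡∑ (cone G) m ⟩
  ∑[ f ← allVecs (suc (n G)) m ] 𝟙 (proper? (cone G) (lookup f))
    ≡⟨ ∑-cartesianProductWith _ (allVecs (n G) m) (allFin m) _ ⟩
  ∑[ f ← allVecs (n G) m ] ∑[ c ← allFin m ] 𝟙 (proper? (cone G) (lookup (c ∷ f)))
    ≤⟨ ∑-mono (allVecs (n G) m) (λ f → ∑-mono (allFin m) (λ c →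
         𝟙-mono (proper? (cone G) (lookup (c ∷ f))) (good? straight (c ∷ f)) (proper⇒good f c))) ⟩
  ∑[ f ← allVecs (n G) m ] ∑[ c ← allFin m ] 𝟙 (good? straight (c ∷ f))
    ≡⟨ ∑-good straight ⟩
  ∑[ f ← allVecs (n G) m ] (𝟙 (none? straight f es) * free f)
    ≤⟨ straight-minimal (twist C) (twist-symmetric C) (edges-loopless G) (edges-distinct G) m-large ⟩
  ∑[ f ← allVecs (n G) m ] (𝟙 (none? (twist C) f es) * free f)
    ≡⟨ ∑-good (twist C) ⟨
  ∑[ f ← allVecs (n G) m ] ∑[ c ← allFin m ] 𝟙 (good? (twist C) (c ∷ f))
    ≡⟨ ∑-cartesianProductWith _ (allVecs (n G) m) (allFin m) _ ⟨
  ∑[ f ← allVecs (suc (n G)) m ] 𝟙 (good? (twist C) f)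
    ≤⟨ Labelling.colourings≤PDPcover (straightened C) (good? (twist C)) good⇒nonAdjacent ⟩
  PDPcover C ∎
  where
  open ≤-Reasoning
  open Labelling (straightened C)
  es = edges G
  instance
    m≢0 : NonZero m
    -- `G` has a vertex, so the summand `n G` of the threshold forces `m` to be positive.
    m≢0 = >-nonZero (≤-trans (nonempty G) (≤-trans (m≤m+n _ _) m-large))
  Good : Twist (n G) m → Vec (Fin m) (suc (n G)) → Set
  Good σ (c ∷ f) = All (¬_ ∘ Conflict σ f) es × Avoids f c
  good? : ∀ σ f → Dec (Good σ f)
  good? σ (c ∷ f) = none? σ f es ×-dec avoids? f c
  ∑-good : ∀ σ → ∑[ f ← allVecs (n G) m ] ∑[ c ← allFin m ] 𝟙 (good? σ (c ∷ f))
               ≡ ∑[ f ← allVecs (n G) m ] (𝟙 (none? σ f es) * free f)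
  ∑-good σ = ∑-cong (allVecs (n G) m) (λ f → trans
    (∑-cong (allFin m) (λ c → 𝟙-×-dec (none? σ f es) (avoids? f c)))
    (sym (*-distribˡ-∑ (allFin m) (𝟙 (none? σ f es)) _)))
  proper⇒good : ∀ f c → T (proper (cone G) (lookup (c ∷ f))) → Good straight (c ∷ f)
  proper⇒good f c t =
      All.tabulate (λ {(u , v)} e∈ conf → ok (suc u) (suc v) (proj₂ (∈-edges⁻ G e∈)) (sym conf))
    , λ z eq → ok (suc z) zero refl eq
    where
    ok = proper⁻ (cone G) t
  adjacent : ∀ {u v i j} → suc u ≢ suc v → adjH C (ι (suc u) i) (ι (suc v) j) ≡ true → adj G u v ≡ true
  adjacent {u} {v} {i} {j} u≢v e = subst (λ (x , y) → adj (cone G) x y ≡ true) owners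
    (respects C _ _ e (λ eq → u≢v (trans (sym (owner-ι (suc u) i)) (trans eq (owner-ι (suc v) j)))))
    where
    owners : (owner C (ι (suc u) i) , owner C (ι (suc v) j)) ≡ (suc u , suc v)
    owners = cong₂ _,_ (owner-ι (suc u) i) (owner-ι (suc v) j)
  good⇒nonAdjacent : ∀ f → Good (twist C) f → NonAdjacent f
  good⇒nonAdjacent (c ∷ f) (¬conf , av) zero    zero    u≢v e = u≢v refl
  good⇒nonAdjacent (c ∷ f) (¬conf , av) zero    (suc v) u≢v e = av v (sym (apex-straight C v e))
  good⇒nonAdjacent (c ∷ f) (¬conf , av) (suc u) zero    u≢v e = av u (sym (apex-straight C u (trans (adjH-sym C _ _) e)))
  good⇒nonAdjacent (c ∷ f) (¬conf , av) (suc u) (suc v) u≢v e with <-cmp u v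
  ... | tri≈ _ refl _ = u≢v refl
  ... | tri< u<v _ _ = All.lookup ¬conf (∈-edges⁺ G u<v (adjacent u≢v e)) (twist-spec C u<v e)
  ... | tri> _ _ v<u = All.lookup ¬conf (∈-edges⁺ G v<u (adjacent (u≢v ∘ sym) (trans (adjH-sym C _ _) e)))
                         (twist-spec C v<u (trans (adjH-sym C _ _) e))

-- The untwisted cover

map-unique : ∀ {g : A → B} {xs} → (∀ {x y} → x ∈ xs → y ∈ xs → g x ≡ g y → x ≡ y) → Unique xs → Unique (map g xs)
map-unique inj []         = []
map-unique {g = g} {x ∷ xs} inj (x∉ ∷ xs!) =
  All.tabulate (λ y∈ gx≡y → let z , z∈ , y≡gz = ∈-map⁻ g y∈ in All.lookup x∉ z∈ (inj (here refl) (there z∈) (trans gx≡y y≡gz)))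
  ∷ map-unique (λ x∈ y∈ → inj (there x∈) (there y∈)) xs!

module _ {G m} (C : Cover G m) (s : Subset (N C)) (indep : T (independent C s)) where

  independent-owner-injective : ∀ {x y} → T (lookup s x) → T (lookup s y) → owner C x ≡ owner C y → x ≡ y
  independent-owner-injective {x} {y} x∈ y∈ eq with x ≟ y
  ... | yes x≡y = x≡y
  ... | no  x≢y = ⊥-elim (independent⁻ C s indep x y x∈ y∈ (clique C x y eq x≢y))

  -- The members have distinct owners, so together with a missed `u` there would be `n G + 1`
  -- distinct vertices.
  independent-meets : ∣ s ∣ ≡ n G → ∀ u → ∃ λ x → T (lookup s x) × owner C x ≡ u
  independent-meets size u with any? (λ x → T? (lookup s x) ×-dec (owner C x ≟ u))
  ... | yes found = found
  ... | no ∄x = ⊥-elim (1+n≰n (begin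
    suc (n G)                                ≡⟨ cong suc (trans (sym size) (∣∣≡length-members s)) ⟩
    suc (length (members s))                 ≡⟨ cong suc (length-map (owner C) (members s)) ⟨
    length (u ∷ map (owner C) (members s))   ≤⟨ length-≤ (All.tabulate u∉ ∷ owners-unique) (λ _ → ∈-allFin _) ⟩
    length (allFin (n G))                    ≡⟨ length-tabulate {n = n G} id ⟩
    n G                                      ∎))
    where
    open ≤-Reasoning
    ∈-members⁻ : ∀ {x} → x ∈ members s → T (lookup s x)
    ∈-members⁻ x∈ = proj₂ (∈-filter⁻ (T? ∘ lookup s) {xs = allFin (N C)} x∈)
    u∉ : ∀ {v} → v ∈ map (owner C) (members s) → u ≢ v
    u∉ v∈ refl with ∈-map⁻ (owner C) v∈
    ... | x , x∈ , u≡ = ∄x (x , ∈-members⁻ x∈ , sym u≡)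
    owners-unique : Unique (map (owner C) (members s))
    owners-unique = map-unique (λ x∈ y∈ → independent-owner-injective (∈-members⁻ x∈) (∈-members⁻ y∈))
                               (filter⁺ (T? ∘ lookup s) (allFin⁺ (N C)))

T-ext : ∀ {a b} → (T a → T b) → (T b → T a) → a ≡ b
T-ext {true}  {true}  _ _ = refl
T-ext {false} {false} _ _ = refl
T-ext {true}  {false} h _ = ⊥-elim (h _)
T-ext {false} {true}  _ h = ⊥-elim (h _)

module Canonical (G : Graph) (m : ℕ) where

  Point : Set
  Point = Fin (n G) × Fin m

  point : Fin (n G * m) → Point
  point = remQuot {n G} m

  point-injective : Injective _≡_ _≡_ point
  point-injective {x} {y} eq = trans (sym (combine-remQuot {n G} m x))
    (trans (cong (λ (u , i) → combine u i) eq) (combine-remQuot {n G} m y))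

  -- Adjacency in the Cartesian product of `G` with the complete graph on `m` colours.
  Link : Point → Point → Set
  Link (u , i) (v , j) = (u ≡ v × i ≢ j) ⊎ (adj G u v ≡ true × i ≡ j)

  link? : ∀ p q → Dec (Link p q)
  link? (u , i) (v , j) = ((u ≟ v) ×-dec ¬? (i ≟ j)) ⊎-dec ((adj G u v ≟ᵇ true) ×-dec (i ≟ j))

  link-sym : ∀ {p q} → Link p q → Link q p
  link-sym (inj₁ (u≡v , i≢j)) = inj₁ (sym u≡v , i≢j ∘ sym)
  link-sym (inj₂ (e , i≡j))   = inj₂ (trans (adj-sym G _ _) e , sym i≡j)

  link-irr : ∀ {p} → ¬ Link p p
  link-irr (inj₁ (_ , i≢i)) = i≢i refl
  link-irr {u , _} (inj₂ (e , _)) with trans (sym e) (adj-irr G u)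
  ... | ()

  linked : ∀ x y → ⌊ link? (point x) (point y) ⌋ ≡ true → Link (point x) (point y)
  linked x y e = toWitness (≡⇒T e)

  canonical : Cover G m
  canonical = record
    { N        = n G * m
    ; adjH     = λ x y → ⌊ link? (point x) (point y) ⌋
    ; adjH-sym = λ x y → T-ext (λ t → fromWitness (link-sym (toWitness t))) (λ t → fromWitness (link-sym (toWitness t)))
    ; adjH-irr = λ x → T-ext (λ t → link-irr {point x} (toWitness t)) λ ()
    ; owner    = proj₁ ∘ point
    ; fold     = canonical-fold
    ; clique   = λ x y o≡ x≢y → T⇒≡ (fromWitness (inj₁ (o≡ , λ c≡ → x≢y (point-injective (cong₂ _,_ o≡ c≡)))))
    ; respects = canonical-respects
    ; matching = canonical-matching
    }
    where
    canonical-fold : ∀ u → count (λ x → ⌊ proj₁ (point x) ≟ u ⌋) (allFin (n G * m)) ≡ m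
    canonical-fold u = trans (≤-antisym
        (length-≤ (filter⁺ p? (allFin⁺ _)) fibre⊆)
        (length-≤ (map⁺ (combine-injectiveʳ u _ u _) (allFin⁺ m)) ⊆fibre))
      (trans (length-map (combine u) (allFin m)) (length-tabulate {n = m} id))
      where
      p? = λ x → T? ⌊ proj₁ (point x) ≟ u ⌋
      fibre⊆ : ∀ {x} → x ∈ filter p? (allFin (n G * m)) → x ∈ map (combine u) (allFin m)
      fibre⊆ {x} x∈ = subst (_∈ _)
        (trans (cong (λ v → combine v (proj₂ (point x))) (sym (toWitness (proj₂ (∈-filter⁻ p? {xs = allFin (n G * m)} x∈)))))
               (combine-remQuot {n G} m x))
        (∈-map⁺ (combine u) (∈-allFin (proj₂ (point x))))
      ⊆fibre : ∀ {x} → x ∈ map (combine u) (allFin m) → x ∈ filter p? (allFin (n G * m))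
      ⊆fibre x∈ with ∈-map⁻ (combine u) x∈
      ... | i , _ , refl = ∈-filter⁺ p? (∈-allFin _) (fromWitness (cong proj₁ (remQuot-combine u i)))
    canonical-respects : ∀ x y → ⌊ link? (point x) (point y) ⌋ ≡ true → proj₁ (point x) ≢ proj₁ (point y) →
                         adj G (proj₁ (point x)) (proj₁ (point y)) ≡ true
    canonical-respects x y e o≢ with linked x y e
    ... | inj₁ (o≡ , _)  = ⊥-elim (o≢ o≡)
    ... | inj₂ (adj , _) = adj
    canonical-matching : ∀ x y z → ⌊ link? (point x) (point y) ⌋ ≡ true → ⌊ link? (point x) (point z) ⌋ ≡ true →
                         proj₁ (point y) ≡ proj₁ (point z) → proj₁ (point x) ≢ proj₁ (point y) → y ≡ z
    canonical-matching x y z e e′ oy≡oz ox≢oy with linked x y e | linked x z e′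
    ... | inj₁ (ox≡oy , _)  | _                 = ⊥-elim (ox≢oy ox≡oy)
    ... | inj₂ _            | inj₁ (ox≡oz , _)  = ⊥-elim (ox≢oy (trans ox≡oz (sym oy≡oz)))
    ... | inj₂ (_ , cx≡cy)  | inj₂ (_ , cx≡cz)  = point-injective (cong₂ _,_ oy≡oz (trans (sym cx≡cy) cx≡cz))

  canonical-labelling : Labelling canonical
  canonical-labelling = record
    { ι       = combine
    ; owner-ι = λ u i → cong proj₁ (remQuot-combine u i)
    ; ι-inj   = λ u → combine-injectiveʳ u _ u _
    }

  open Labelling canonical-labelling

  -- Such a set meets every list exactly once. The colours met form `f`, and an edge with equal
  -- colours at its ends would be a link inside the set.
  independent⇒transversal : ∀ s → ∣ s ∣ ≡ n G → T (independent canonical s) →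
                            ∃ λ f → T (proper G (lookup f)) × s ≡ transversal f
  independent⇒transversal s size indep = f , f-proper , trans (sym (tabulate∘lookup s))
      (trans (tabulate-cong (λ y → T-ext (∈-transversal⁺ f ∘ ⇒f y) (f⇒ y ∘ ∈-transversal⁻ f))) (tabulate∘lookup (transversal f)))
    where
    meet : ∀ u → ∃ λ x → T (lookup s x) × proj₁ (point x) ≡ u
    meet = independent-meets canonical s indep size
    f : Vec (Fin m) (n G)
    f = Vec.tabulate (λ u → proj₂ (point (proj₁ (meet u))))
    point-meet : ∀ u → point (proj₁ (meet u)) ≡ (u , lookup f u)
    point-meet u = cong₂ _,_ (proj₂ (proj₂ (meet u))) (sym (lookup∘tabulate _ u))
    meet≡ : ∀ u → proj₁ (meet u) ≡ combine u (lookup f u)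
    meet≡ u = trans (sym (combine-remQuot {n G} m _)) (cong (λ (u , i) → combine u i) (point-meet u))
    ⇒f : ∀ y → T (lookup s y) → y ≡ combine (proj₁ (point y)) (lookup f (proj₁ (point y)))
    ⇒f y y∈ = let x , x∈ , ox≡oy = meet (proj₁ (point y)) in
      trans (independent-owner-injective canonical s indep y∈ x∈ (sym ox≡oy)) (meet≡ (proj₁ (point y)))
    f⇒ : ∀ y → y ≡ combine (proj₁ (point y)) (lookup f (proj₁ (point y))) → T (lookup s y)
    f⇒ y y≡ = let x , x∈ , _ = meet (proj₁ (point y)) in
      subst (T ∘ lookup s) (trans (meet≡ (proj₁ (point y))) (sym y≡)) x∈
    f-proper : T (proper G (lookup f))
    f-proper = proper⁺ G λ u v e fu≡fv →
      let x , x∈ , _ = meet u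
          y , y∈ , _ = meet v in
      independent⁻ canonical s indep x y x∈ y∈
        (T⇒≡ (fromWitness (subst (λ (p , q) → Link p q) (sym (cong₂ _,_ (point-meet u) (point-meet v))) (inj₂ (e , fu≡fv)))))

  -- One direction suffices: for the cone the other is an instance of the lower bound `P≤PDPcover`.
  PDPcover-canonical≤P : PDPcover canonical ≤ P G m
  PDPcover-canonical≤P = begin
    PDPcover canonical
      ≤⟨ length-≤ (filter⁺ _ (allSubsets-unique (n G * m))) included ⟩
    length (map transversal (filter (proper? G ∘ lookup) (allVecs (n G) m)))
      ≡⟨ length-map transversal (filter (proper? G ∘ lookup) (allVecs (n G) m)) ⟩
    length (filter (proper? G ∘ lookup) (allVecs (n G) m))
      ≡⟨ length-filter (proper? G ∘ lookup) (allVecs (n G) m) ⟩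
    ∑[ f ← allVecs (n G) m ] 𝟙 (proper? G (lookup f))
      ≡⟨ P≡∑ G m ⟨
    P G m ∎
    where
    open ≤-Reasoning
    included : ∀ {s} → s ∈ filterᵇ (λ s → (∣ s ∣ ≡ᵇ n G) ∧ independent canonical s) (allSubsets (n G * m)) →
               s ∈ map transversal (filter (proper? G ∘ lookup) (allVecs (n G) m))
    included {s} s∈ with Equivalence.to (T-∧ {∣ s ∣ ≡ᵇ n G})
      (proj₂ (∈-filter⁻ (λ s → T? ((∣ s ∣ ≡ᵇ n G) ∧ independent canonical s)) {xs = allSubsets (n G * m)} s∈))
    ... | size , indep with independent⇒transversal s (≡ᵇ⇒≡ _ _ size) indep
    ...   | f , f-proper , refl = ∈-map⁺ transversal (∈-filter⁺ (proper? G ∘ lookup) (∈-allVecs f) f-proper)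

theorem7 : (G : Graph) → Σ ℕ (λ N → (m : ℕ) → N ≤ m → PDP≡ (cone G) m (P (cone G) m))
theorem7 G = threshold G , λ m m-large →
  let open Canonical (cone G) m in
  (canonical , ≤-antisym PDPcover-canonical≤P (P≤PDPcover G m-large canonical)) , P≤PDPcover G m-large
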